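{- The variety of Dedekind $\sigma$-complete truncated Riesz spaces is generated by $\mathbb{R}$; that is, it is the smallest class of algebras (in its signature) that contains $\mathbb{R}$ and is closed under products, subalgebras and homomorphic images.
   Context: For a Riesz space (vector lattice) $G$, $G^+=\{x\in G\mid x\geq0\}$, $f^+=f\lor0$, $f^-=-(f\land 0)$, and $\omega=\{0,1,2,\dots\}$. A truncated Riesz space is a Riesz space $G$ with a unary operation $\overline{\,\cdot\,}\colon G\to G$ such that: (T1) $\overline{f}=\overline{f^+}-f^-$ for all $f\in G$; (T2) $\overline{f}\in G^+$ for all $f\in G^+$; (T3) $f\land\overline{g}\leq\overline{f}\leq f$ for all $f,g\in G^+$; (T4) for $f\in G^+$, $\overline f=0$ implies $f=0$; (T5) for $f\in G^+$, if $nf=\overline{nf}$ for every $n\in\omega$ then $f=0$. A lattice is Dedekind $\sigma$-complete if every nonempty countable subset that has an upper bound has a supremum. On a Dedekind $\sigma$-complete lattice one defines the operation of countably infinite arity $\curlyvee(g,f_0,f_1,\dots)=\sup_{n\in\omega}\{f_n\land g\}$, also written $\curlyvee^g_{n\in\omega}f_n$. Dedekind $\sigma$-complete truncated Riesz spaces are regarded as algebras with primitive operations $0$, $+$, $\lor$, $\lambda(\,\cdot\,)$ (for each $\lambda\in\mathbb{R}$), $\curlyvee$ and $\overline{\,\cdot\,}$. As such they form an (infinitary) variety, axiomatised by the axioms of Riesz spaces together with: $\curlyvee^g_{n\in\omega}f_n=\curlyvee^g_{n\in\omega}(f_n\land g)$; $\curlyvee(g,f_0,f_1,f_2,\dots)=(f_0\land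 g)\lor\curlyvee(g,f_1,f_2,\dots)$; $\curlyvee^g_{n\in\omega}(f_n\land h)\leq h$; (T1), (T2), (T3); and, for all $f\in G^+$, $f=\curlyvee^f_{n\in\omega}n\overline{f}$ and $f=\curlyvee^f_{n\in\omega}(nf-\overline{nf})$. The algebra $\mathbb{R}$ has its usual operations, with $\overline{x}=x\land1$ and $\curlyvee(y,x_0,x_1,\dots)=\sup_{n\in\omega}\{x_n\land y\}$. -}

module Defs where

open import Level using (Level; suc)
open import Data.Nat.Base using (ℕ)
open import Data.Product.Base using (∃; _×_; _,_; proj₁; proj₂)
open import Relation.Nullary.Negation.Core using (¬_)
open import Relation.Unary using (Pred)
open import Relation.Binary.Core using (Rel)
open import Relation.Binary.Structures using (IsEquivalence; IsTotalOrder)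
open import Relation.Binary.Bundles using (TotalOrder)
open import Function.Definitions using (Injective; StrictlySurjective)
open import Algebra.Bundles using (CommutativeRing; RawMonoid)
open import Algebra.Module.Structures using (IsLeftModule)
open import Algebra.Lattice.Structures using (IsLattice)
import Algebra.Definitions.RawMonoid as NatMultiple
import Algebra.Construct.NaturalChoice.Max as Max
import Algebra.Construct.NaturalChoice.Min as Min

module _ {ℓ : Level} {A : Set ℓ} where

  IsUpperBound : Rel A ℓ → Pred A ℓ → A → Set ℓ
  IsUpperBound _≤_ P u = ∀ x → P x → x ≤ u

  IsSupremum : Rel A ℓ → Pred A ℓ → A → Set ℓ
  IsSupremum _≤_ P s =
    IsUpperBound _≤_ P s × (∀ u → IsUpperBound _≤_ P u → s ≤ u)

  -- The nonempty countable subsets are exactly the ranges of sequences.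
  Range : Rel A ℓ → (ℕ → A) → Pred A ℓ
  Range _≈_ f x = ∃ λ n → x ≈ f n

-- The field of real numbers, characterised (uniquely up to isomorphism)
-- as a Dedekind complete totally ordered field.

record CompleteOrderedField (ℓ : Level) : Set (suc ℓ) where
  infix 4 _≤_
  field
    commutativeRing : CommutativeRing ℓ ℓ

  open CommutativeRing commutativeRing public

  field
    _≤_           : Rel Carrier ℓ
    isTotalOrder  : IsTotalOrder _≈_ _≤_
    +-monoʳ-≤     : ∀ x {y z} → y ≤ z → (x + y) ≤ (x + z)
    *-nonNegative : ∀ {x y} → 0# ≤ x → 0# ≤ y → 0# ≤ (x * y)
    0#≉1#         : ¬ (0# ≈ 1#)
    inverse       : ∀ x → ¬ (x ≈ 0#) → ∃ λ y → (x * y) ≈ 1#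
    complete      : (P : Pred Carrier ℓ) → ∃ P → ∃ (IsUpperBound _≤_ P) →
                    ∃ (IsSupremum _≤_ P)

  totalOrder : TotalOrder ℓ ℓ ℓ
  totalOrder = record { isTotalOrder = isTotalOrder }

  open IsTotalOrder isTotalOrder public
    using (total; antisym; ≤-respʳ-≈)
    renaming (refl to ≤-refl; reflexive to ≤-reflexive; trans to ≤-trans)
  open Max totalOrder public using (_⊔_; ⊔-cong)
  open Min totalOrder public using (_⊓_; ⊓-cong; x⊓y≤y)

  module _ (y : Carrier) (x : ℕ → Carrier) where

    private
      truncated-sup : ∃ (IsSupremum _≤_ (Range _≈_ λ n → x n ⊓ y))
      truncated-sup = complete (Range _≈_ λ n → x n ⊓ y)
        (x 0 ⊓ y , 0 , refl)
        (y , λ z (n , z≈) → ≤-trans (≤-reflexive z≈) (x⊓y≤y (x n) y))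

    sup⊓ : Carrier
    sup⊓ = proj₁ truncated-sup

    sup⊓-isSupremum : IsSupremum _≤_ (Range _≈_ λ n → x n ⊓ y) sup⊓
    sup⊓-isSupremum = proj₂ truncated-sup

  sup⊓-mono : ∀ {y y′ x x′} → y ≈ y′ → (∀ n → x n ≈ x′ n) →
              sup⊓ y x ≤ sup⊓ y′ x′
  sup⊓-mono {y} {y′} {x} {x′} y≈ x≈ =
    proj₂ (sup⊓-isSupremum y x) (sup⊓ y′ x′) λ z (n , z≈) →
      proj₁ (sup⊓-isSupremum y′ x′) z (n , trans z≈ (⊓-cong (x≈ n) y≈))

  sup⊓-cong : ∀ {y y′ x x′} → y ≈ y′ → (∀ n → x n ≈ x′ n) →
              sup⊓ y x ≈ sup⊓ y′ x′
  sup⊓-cong y≈ x≈ =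
    antisym (sup⊓-mono y≈ x≈) (sup⊓-mono (sym y≈) (λ n → sym (x≈ n)))

module _ {ℓ : Level} (ℝ : CompleteOrderedField ℓ) where

  private module ℝ = CompleteOrderedField ℝ

  -- Algebras in the infinitary signature 0, +, ∨, λ(·) (λ ∈ ℝ), ⋎,
  -- truncation.  No equational axioms are imposed; equality is a setoid
  -- equality, so quotients are obtained by coarsening it.

  record σAlgebra : Set (suc ℓ) where
    infix  4 _≈_ _≤_
    infixl 6 _+_ _-_
    infixl 6 _∨_
    infixl 7 _∧_
    infixr 8 _·_
    infixl 9 _⁺ _⁻
    field
      Carrier       : Set ℓ
      _≈_           : Rel Carrier ℓ
      isEquivalence : IsEquivalence _≈_
      0#            : Carrier
      _+_           : Carrier → Carrier → Carrier
      _∨_           : Carrier → Carrier → Carrier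
      _·_           : ℝ.Carrier → Carrier → Carrier
      ⋎             : Carrier → (ℕ → Carrier) → Carrier
      trunc         : Carrier → Carrier
      +-cong        : ∀ {f f′ g g′} → f ≈ f′ → g ≈ g′ → (f + g) ≈ (f′ + g′)
      ∨-cong        : ∀ {f f′ g g′} → f ≈ f′ → g ≈ g′ → (f ∨ g) ≈ (f′ ∨ g′)
      ·-cong        : ∀ {a b f f′} → a ℝ.≈ b → f ≈ f′ → (a · f) ≈ (b · f′)
      ⋎-cong        : ∀ {g g′ f f′} → g ≈ g′ → (∀ n → f n ≈ f′ n) →
                      ⋎ g f ≈ ⋎ g′ f′
      trunc-cong    : ∀ {f f′} → f ≈ f′ → trunc f ≈ trunc f′

    -- ∧ is not primitive: in a Riesz space f ∧ g = -(-f ∨ -g).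

    neg : Carrier → Carrier
    neg f = (ℝ.- ℝ.1#) · f

    _-_ : Carrier → Carrier → Carrier
    f - g = f + neg g

    _∧_ : Carrier → Carrier → Carrier
    f ∧ g = neg (neg f ∨ neg g)

    _≤_ : Rel Carrier ℓ
    f ≤ g = (f ∨ g) ≈ g

    _⁺ : Carrier → Carrier
    f ⁺ = f ∨ 0#

    _⁻ : Carrier → Carrier
    f ⁻ = neg (f ∧ 0#)

    +-rawMonoid : RawMonoid ℓ ℓ
    +-rawMonoid = record { _≈_ = _≈_ ; _∙_ = _+_ ; ε = 0# }

    open NatMultiple +-rawMonoid public
      using () renaming (_×_ to infixr 8 _×ℕ_)

  record IsRieszSpace (G : σAlgebra) : Set ℓ where
    open σAlgebra G
    field
      isVectorSpace : IsLeftModule ℝ.ring _≈_ _+_ 0# neg _·_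
      isLattice     : IsLattice _≈_ _∨_ _∧_
      +-mono        : ∀ {f g} h → f ≤ g → (f + h) ≤ (g + h)
      ·-nonNegative : ∀ {a f} → ℝ.0# ℝ.≤ a → 0# ≤ f → 0# ≤ (a · f)

  record IsTruncation (G : σAlgebra) : Set ℓ where
    open σAlgebra G
    field
      T1  : ∀ f → trunc f ≈ trunc (f ⁺) - f ⁻
      T2  : ∀ f → 0# ≤ f → 0# ≤ trunc f
      T3ˡ : ∀ f g → 0# ≤ f → 0# ≤ g → (f ∧ trunc g) ≤ trunc f
      T3ʳ : ∀ f → 0# ≤ f → trunc f ≤ f
      T4  : ∀ f → 0# ≤ f → trunc f ≈ 0# → f ≈ 0#
      T5  : ∀ f → 0# ≤ f → (∀ n → n ×ℕ f ≈ trunc (n ×ℕ f)) → f ≈ 0#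

  IsDedekindσComplete : σAlgebra → Set ℓ
  IsDedekindσComplete G =
    ∀ f → ∃ (IsUpperBound _≤_ (Range _≈_ f)) → ∃ (IsSupremum _≤_ (Range _≈_ f))
    where open σAlgebra G

  record IsDedekindσCompleteTruncatedRieszSpace (G : σAlgebra) : Set ℓ where
    open σAlgebra G
    field
      isRieszSpace        : IsRieszSpace G
      isTruncation        : IsTruncation G
      isDedekindσComplete : IsDedekindσComplete G
      ⋎-isSupremum        : ∀ g f →
        IsSupremum _≤_ (Range _≈_ λ n → f n ∧ g) (⋎ g f)

  ℝ-algebra : σAlgebra
  ℝ-algebra = record
    { Carrier       = ℝ.Carrier
    ; _≈_           = ℝ._≈_
    ; isEquivalence = ℝ.isEquivalence
    ; 0#            = ℝ.0#
    ; _+_           = ℝ._+_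
    ; _∨_           = ℝ._⊔_
    ; _·_           = ℝ._*_
    ; ⋎             = ℝ.sup⊓
    ; trunc         = λ x → x ℝ.⊓ ℝ.1#
    ; +-cong        = ℝ.+-cong
    ; ∨-cong        = ℝ.⊔-cong
    ; ·-cong        = ℝ.*-cong
    ; ⋎-cong        = ℝ.sup⊓-cong
    ; trunc-cong    = λ x≈ → ℝ.⊓-cong x≈ ℝ.refl
    }

  ∏ : (I : Set ℓ) → (I → σAlgebra) → σAlgebra
  ∏ I A = record
    { Carrier       = ∀ i → A.Carrier i
    ; _≈_           = λ f g → ∀ i → A._≈_ i (f i) (g i)
    ; isEquivalence = record
      { refl  = λ i → IsEquivalence.refl (A.isEquivalence i)
      ; sym   = λ p i → IsEquivalence.sym (A.isEquivalence i) (p i)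
      ; trans = λ p q i → IsEquivalence.trans (A.isEquivalence i) (p i) (q i)
      }
    ; 0#            = λ i → A.0# i
    ; _+_           = λ f g i → A._+_ i (f i) (g i)
    ; _∨_           = λ f g i → A._∨_ i (f i) (g i)
    ; _·_           = λ a f i → A._·_ i a (f i)
    ; ⋎             = λ g f i → A.⋎ i (g i) (λ n → f n i)
    ; trunc         = λ f i → A.trunc i (f i)
    ; +-cong        = λ p q i → A.+-cong i (p i) (q i)
    ; ∨-cong        = λ p q i → A.∨-cong i (p i) (q i)
    ; ·-cong        = λ p q i → A.·-cong i p (q i)
    ; ⋎-cong        = λ p q i → A.⋎-cong i (p i) (λ n → q n i)
    ; trunc-cong    = λ p i → A.trunc-cong i (p i)
    }
    where module A (i : I) = σAlgebra (A i)

  record IsHomomorphism (A B : σAlgebra)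
    (h : σAlgebra.Carrier A → σAlgebra.Carrier B) : Set ℓ where
    private
      module A = σAlgebra A
      module B = σAlgebra B
    field
      cong       : ∀ {x y} → x A.≈ y → h x B.≈ h y
      0#-homo    : h A.0# B.≈ B.0#
      +-homo     : ∀ x y → h (x A.+ y) B.≈ (h x B.+ h y)
      ∨-homo     : ∀ x y → h (x A.∨ y) B.≈ (h x B.∨ h y)
      ·-homo     : ∀ a x → h (a A.· x) B.≈ (a B.· h x)
      ⋎-homo     : ∀ y x → h (A.⋎ y x) B.≈ B.⋎ (h y) (λ n → h (x n))
      trunc-homo : ∀ x → h (A.trunc x) B.≈ B.trunc (h x)

  -- Subalgebras are taken up to isomorphism.
  _EmbedsIn_ : σAlgebra → σAlgebra → Set ℓ
  A EmbedsIn B = ∃ λ h → IsHomomorphism A B h ×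
    Injective (σAlgebra._≈_ A) (σAlgebra._≈_ B) h

  _IsHomomorphicImageOf_ : σAlgebra → σAlgebra → Set ℓ
  B IsHomomorphicImageOf A = ∃ λ h → IsHomomorphism A B h ×
    StrictlySurjective (σAlgebra._≈_ B) h

  record ClosedUnderHSP {κ : Level} (K : Pred σAlgebra κ) : Set (suc ℓ Level.⊔ κ) where
    field
      products    : ∀ (I : Set ℓ) (A : I → σAlgebra) → (∀ i → K (A i)) → K (∏ I A)
      subalgebras : ∀ A B → A EmbedsIn B → K B → K A
      images      : ∀ A B → B IsHomomorphicImageOf A → K A → K B

{-# OPTIONS --safe #-}

-- Closure under HSP holds because (T4) and (T5) can be replaced by the
-- equations f = ⋎ᶠ n f̄ and f = ⋎ᶠ (n f - trunc (n f)).  For generation, every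
-- G is the image under evaluation of the algebra of those functions ℝ^G → ℝ
-- that are given by terms over G, so one must show that a term u with
-- 0 ≤ u ≉ 0 in G is nonzero in ℝ under some valuation.  This is a
-- Rasiowa–Sikorski argument.  By (T5) some h = n u differs from its truncation
-- e, and on the band of h - e truncation is the meet with the weak unit e.  A
-- decreasing sequence of positive elements of that band is chosen to meet
-- countably many dense requirements: every variable of u gets confined between
-- arbitrarily close multiples of e, and every ⋎ occurring in u is nearly
-- attained by one of its members.  The value of g ∈ G is the number to which it
-- gets confined; then every subterm takes in ℝ the limit of its value in G, and
-- h ≥ e prevents this limit from being 0 for u.

module Submission where

open import Defs
open import Level using (Level; Lift; lift) renaming (_⊔_ to _⊔ˡ_)
open import Data.Nat.Base as ℕ using (ℕ; zero; suc)
import Data.Nat.Properties as ℕ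
open import Data.Fin.Base using (Fin)
open import Data.Product.Base using (∃; Σ; _×_; _,_; proj₁; proj₂)
open import Data.Sum.Base using (_⊎_; inj₁; inj₂; [_,_]′)
open import Data.Unit.Base using (⊤; tt)
open import Data.Vec.Base using (Vec; lookup)
open import Data.Vec.N-ary using (N-ary; Eq; curryⁿ; curryⁿ-cong)
open import Function.Base using (_∘_; const)
open import Relation.Nullary.Negation.Core using (¬_; contradiction)
open import Relation.Nullary.Decidable.Core using (yes; no)
open import Relation.Unary using (Pred; _⊆_)
open import Relation.Binary.Core using (Rel)
open import Relation.Binary.Structures
  using (IsEquivalence; IsPartialOrder; IsTotalOrder)
open import Relation.Binary.PropositionalEquality.Core as ≡ using (_≡_)
import Relation.Binary.Reasoning.Setoid as SetoidReasoning
import Relation.Binary.Reflection as Reflection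
open import Algebra.Bundles using (AbelianGroup)
open import Algebra.Lattice.Structures using (IsLattice)
open import Algebra.Module.Structures using (IsLeftModule)
import Algebra.Construct.NaturalChoice.Max as Max
import Algebra.Construct.NaturalChoice.Min as Min
import Algebra.Construct.NaturalChoice.MinMaxOp as MinMaxOp
import Algebra.Lattice.Properties.Lattice as LatticeProperties
import Algebra.Properties.AbelianGroup as AbelianGroupProperties
import Algebra.Properties.CommutativeMonoid.Mult as Mult
import Algebra.Properties.CommutativeSemigroup as CommutativeSemigroupProperties
import Algebra.Properties.Ring as RingProperties
import Algebra.Properties.Semiring.Mult as SemiringMult
import Algebra.Solver.CommutativeMonoid.Normal as CommutativeMonoidNormal
open import Axiom.ExcludedMiddle using (ExcludedMiddle)

-- Equations in abelian groups

-- An expression denotes a difference of two positive ones, so an equation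
-- between expressions reduces to one in the commutative monoid.
module AbelianGroupSolver {c ℓ : Level} (G : AbelianGroup c ℓ) where

  open AbelianGroup G
  open AbelianGroupProperties G
  open CommutativeSemigroupProperties commutativeSemigroup using (interchange)
  private module CM = CommutativeMonoidNormal commutativeMonoid

  infixl 6 _⊕_
  infix  8 ⊖_

  data Expr (n : ℕ) : Set where
    var : Fin n → Expr n
    𝟘   : Expr n
    _⊕_ : Expr n → Expr n → Expr n
    ⊖_  : Expr n → Expr n

  ⟦_⟧ : ∀ {n} → Expr n → Vec Carrier n → Carrier
  ⟦ var i ⟧ ρ = lookup ρ i
  ⟦ 𝟘 ⟧     ρ = ε
  ⟦ a ⊕ b ⟧ ρ = ⟦ a ⟧ ρ ∙ ⟦ b ⟧ ρ
  ⟦ ⊖ a ⟧   ρ = ⟦ a ⟧ ρ ⁻¹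

  mutual

    positive negative : ∀ {n} → Expr n → CM.Expr n

    positive (var i) = CM.var i
    positive 𝟘       = CM.id
    positive (a ⊕ b) = positive a CM.⊕ positive b
    positive (⊖ a)   = negative a

    negative (var i) = CM.id
    negative 𝟘       = CM.id
    negative (a ⊕ b) = negative a CM.⊕ negative b
    negative (⊖ a)   = positive a

  correct : ∀ {n} (a : Expr n) ρ →
            CM.⟦ positive a ⟧ ρ ≈ ⟦ a ⟧ ρ ∙ CM.⟦ negative a ⟧ ρ
  correct (var i) ρ = sym (identityʳ _)
  correct 𝟘       ρ = sym (identityʳ _)
  correct (a ⊕ b) ρ =
    trans (∙-cong (correct a ρ) (correct b ρ)) (interchange _ _ _ _)
  correct (⊖ a)   ρ = begin
    CM.⟦ negative a ⟧ ρ                             ≈⟨ identityˡ _ ⟨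
    ε ∙ CM.⟦ negative a ⟧ ρ                         ≈⟨ ∙-congʳ (inverseˡ _) ⟨
    ⟦ a ⟧ ρ ⁻¹ ∙ ⟦ a ⟧ ρ ∙ CM.⟦ negative a ⟧ ρ      ≈⟨ assoc _ _ _ ⟩
    ⟦ a ⟧ ρ ⁻¹ ∙ (⟦ a ⟧ ρ ∙ CM.⟦ negative a ⟧ ρ)    ≈⟨ ∙-congˡ (correct a ρ) ⟨
    ⟦ a ⟧ ρ ⁻¹ ∙ CM.⟦ positive a ⟧ ρ                ∎
    where open SetoidReasoning setoid

  private
    module R = Reflection setoid var ⟦_⟧ ⟦_⟧ (λ _ _ → refl)

  open R public using (_⊜_)

  -- Adding the negative parts of `a` and `b` to both sides leaves expressions without inverses,
  -- which share a normal form in the commutative monoid; the added terms then cancel.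
  prove : ∀ {n} (a b : Expr n) →
          CM.normalise (positive a CM.⊕ negative b) ≡
          CM.normalise (positive b CM.⊕ negative a) →
          ∀ ρ → ⟦ a ⟧ ρ ≈ ⟦ b ⟧ ρ
  prove a b eq ρ = ∙-cancelʳ (n a ∙ n b) _ _ (begin
    ⟦ a ⟧ ρ ∙ (n a ∙ n b)   ≈⟨ assoc _ _ _ ⟨
    ⟦ a ⟧ ρ ∙ n a ∙ n b     ≈⟨ ∙-congʳ (correct a ρ) ⟨
    p a ∙ n b               ≈⟨ CM.correct (positive a CM.⊕ negative b) ρ ⟨
    nf (positive a CM.⊕ negative b) ≡⟨ ≡.cong (λ v → CM.⟦ v ⟧⇓ ρ) eq ⟩
    nf (positive b CM.⊕ negative a) ≈⟨ CM.correct (positive b CM.⊕ negative a) ρ ⟩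
    p b ∙ n a               ≈⟨ ∙-congʳ (correct b ρ) ⟩
    ⟦ b ⟧ ρ ∙ n b ∙ n a     ≈⟨ assoc _ _ _ ⟩
    ⟦ b ⟧ ρ ∙ (n b ∙ n a)   ≈⟨ ∙-congˡ (comm _ _) ⟩
    ⟦ b ⟧ ρ ∙ (n a ∙ n b)   ∎)
    where
    open SetoidReasoning setoid
    p n : Expr _ → Carrier
    p e = CM.⟦ positive e ⟧ ρ
    n e = CM.⟦ negative e ⟧ ρ
    nf : CM.Expr _ → Carrier
    nf e = CM.⟦ CM.normalise e ⟧⇓ ρ

  solve : ∀ n (f : N-ary n (Expr n) (Expr n × Expr n)) →
    let a = proj₁ (R.close n f); b = proj₂ (R.close n f) in
    CM.normalise (positive a CM.⊕ negative b) ≡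
    CM.normalise (positive b CM.⊕ negative a) →
    Eq n _≈_ (curryⁿ ⟦ a ⟧) (curryⁿ ⟦ b ⟧)
  solve n f eq = curryⁿ-cong _≈_ ⟦ a ⟧ ⟦ b ⟧ (prove a b eq)
    where
    a = proj₁ (R.close n f)
    b = proj₂ (R.close n f)

-- Partially ordered abelian groups

module OrderedAbelianGroup {ℓ : Level} (G : AbelianGroup ℓ ℓ)
  {_≤_ : Rel (AbelianGroup.Carrier G) ℓ}
  (isPartialOrder : IsPartialOrder (AbelianGroup._≈_ G) _≤_)
  (+-monoʳ : ∀ x {y z} → y ≤ z → AbelianGroup._∙_ G x y ≤ AbelianGroup._∙_ G x z)
  where

  open AbelianGroup G renaming
    (Carrier to C; _∙_ to _+_; ε to 0#; _⁻¹ to -_; comm to +-comm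
    ; identityˡ to +-identityˡ; identityʳ to +-identityʳ; ∙-congˡ to +-congˡ)
  open IsPartialOrder isPartialOrder public
    using (≤-respʳ-≈; ≤-respˡ-≈)
    renaming (refl to ≤-refl; reflexive to ≤-reflexive; trans to ≤-trans
    ; antisym to ≤-antisym)
  open AbelianGroupSolver G public using (solve; _⊕_; ⊖_; 𝟘; _⊜_)
  open Mult commutativeMonoid public
    using (×-congʳ; ×-assocˡ; ×-distrib-+)
    renaming (_×_ to _×ₙ_)

  +-mono : ∀ {a b c d} → a ≤ b → c ≤ d → (a + c) ≤ (b + d)
  +-mono {a} {b} {c} {d} a≤b c≤d = ≤-trans (+-monoʳ a c≤d)
    (≤-respʳ-≈ (+-comm _ _) (≤-respˡ-≈ (+-comm _ _) (+-monoʳ d a≤b)))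

  -- Every linear consequence of inequalities is obtained by adding them up and
  -- comparing the differences of the two sides.
  linear : ∀ {a b c d} → a ≤ b → (c + (- d)) ≈ (a + (- b)) → c ≤ d
  linear {a} {b} {c} {d} a≤b eq =
    ≤-respʳ-≈ (solve 2 (λ b d → b ⊕ (d ⊕ ⊖ b) ⊜ d) ≡.refl b d)
    (≤-trans
      (≤-reflexive (trans
        (solve 2 (λ c d → c ⊜ (c ⊕ ⊖ d) ⊕ d) ≡.refl c d)
        (trans (AbelianGroup.∙-congʳ G eq)
          (solve 3 (λ a b d → (a ⊕ ⊖ b) ⊕ d ⊜ a ⊕ (d ⊕ ⊖ b)) ≡.refl a b d))))
      (≤-respʳ-≈ (+-comm _ _)
        (≤-respˡ-≈ (+-comm _ _) (+-monoʳ (d + (- b)) a≤b))))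

  neg-anti : ∀ {a b} → a ≤ b → (- b) ≤ (- a)
  neg-anti {a} {b} a≤b =
    linear a≤b (solve 2 (λ a b → ⊖ b ⊕ ⊖ ⊖ a ⊜ a ⊕ ⊖ b) ≡.refl a b)

  sub-nonNeg : ∀ {a b} → a ≤ b → 0# ≤ (b + (- a))
  sub-nonNeg {a} {b} a≤b =
    linear a≤b (solve 2 (λ a b → 𝟘 ⊕ ⊖ (b ⊕ ⊖ a) ⊜ a ⊕ ⊖ b) ≡.refl a b)

  +-nonNeg : ∀ {a b} → 0# ≤ a → 0# ≤ b → 0# ≤ (a + b)
  +-nonNeg 0≤a 0≤b = ≤-respˡ-≈ (+-identityˡ 0#) (+-mono 0≤a 0≤b)

  a≤b+a : ∀ {a b} → 0# ≤ b → a ≤ (b + a)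
  a≤b+a 0≤b = ≤-respˡ-≈ (+-identityˡ _) (+-mono 0≤b ≤-refl)

  a≤a+b : ∀ {a b} → 0# ≤ b → a ≤ (a + b)
  a≤a+b 0≤b = ≤-respˡ-≈ (+-identityʳ _) (+-mono ≤-refl 0≤b)

  a≤a-b⇒b≤0 : ∀ {a b} → a ≤ (a + (- b)) → b ≤ 0#
  a≤a-b⇒b≤0 {a} {b} p =
    linear p (solve 2 (λ a b → b ⊕ ⊖ 𝟘 ⊜ a ⊕ ⊖ (a ⊕ ⊖ b)) ≡.refl a b)

  ×-mono : ∀ n {a b} → a ≤ b → (n ×ₙ a) ≤ (n ×ₙ b)
  ×-mono zero    a≤b = ≤-refl
  ×-mono (suc n) a≤b = +-mono a≤b (×-mono n a≤b)

  ×-zero : ∀ n → (n ×ₙ 0#) ≈ 0#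
  ×-zero zero    = refl
  ×-zero (suc n) = trans (+-identityˡ _) (×-zero n)

  ×-nonNeg : ∀ n {a} → 0# ≤ a → 0# ≤ (n ×ₙ a)
  ×-nonNeg n 0≤a = ≤-respˡ-≈ (×-zero n) (×-mono n 0≤a)

  ×-neg : ∀ n a → (n ×ₙ (- a)) ≈ (- (n ×ₙ a))
  ×-neg zero    a = solve 0 (𝟘 ⊜ ⊖ 𝟘) ≡.refl
  ×-neg (suc n) a = trans (+-congˡ (×-neg n a))
    (solve 2 (λ a b → ⊖ a ⊕ ⊖ b ⊜ ⊖ (a ⊕ b)) ≡.refl a (n ×ₙ a))

  -- `s + (- z)` is then an upper bound, so leastness gives `s ≤ s + (- z)`.
  supremum-gap : ∀ {f : ℕ → C} {s z} → IsSupremum _≤_ (Range _≈_ f) s →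
                 (∀ n → f n ≤ (s + (- z))) → z ≤ 0#
  supremum-gap (_ , least) f≤s-z =
    a≤a-b⇒b≤0 (least _ λ x (n , x≈) → ≤-respˡ-≈ (sym x≈) (f≤s-z n))

  -- The next multiple is still below `s`, so every multiple stays below `s + (- x)`.
  multiples-supremum⇒≤0 : ∀ {x s} →
    IsSupremum _≤_ (Range _≈_ λ n → n ×ₙ x) s → x ≤ 0#
  multiples-supremum⇒≤0 {x} {s} sup@(upper , _) = supremum-gap sup λ n →
    linear (upper _ (suc n , refl))
      (solve 3 (λ nx s x → nx ⊕ ⊖ (s ⊕ ⊖ x) ⊜ (x ⊕ nx) ⊕ ⊖ s) ≡.refl (n ×ₙ x) s x)

-- Riesz spaces

module RieszSpace {ℓ : Level} (ℝ : CompleteOrderedField ℓ) (G : σAlgebra ℝ)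
  (isRieszSpace : IsRieszSpace ℝ G) where

  private module ℝ = CompleteOrderedField ℝ
  open σAlgebra G public
  open IsRieszSpace isRieszSpace public using (isVectorSpace; isLattice; ·-nonNegative)
  open IsLeftModule isVectorSpace public
    using ()
    renaming (*ₗ-zeroˡ to ·-zeroˡ; *ₗ-distribʳ to ·-distribʳ
    ; *ₗ-identityˡ to ·-identityˡ; *ₗ-assoc to ·-assoc; *ₗ-zeroʳ to ·-zeroʳ
    ; *ₗ-distribˡ to ·-distribˡ)
  open IsLattice isLattice public
    using (∨-comm; ∨-assoc; ∧-comm; ∧-assoc; ∧-cong; ∨-absorbs-∧; ∧-absorbs-∨)

  +-abelianGroup : AbelianGroup ℓ ℓ
  +-abelianGroup = record
    { isAbelianGroup = IsLeftModule.+ᴹ-isAbelianGroup isVectorSpace }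

  open AbelianGroup +-abelianGroup public
    using (refl; sym; trans)
    renaming (⁻¹-cong to neg-cong; identityˡ to +-identityˡ; identityʳ to +-identityʳ
             ; comm to +-comm; assoc to +-assoc; inverseʳ to +-inverseʳ)

  private
    ∨-idem = LatticeProperties.∨-idem (record { isLattice = isLattice })

  ≤-isPartialOrder : IsPartialOrder _≈_ _≤_
  ≤-isPartialOrder = record
    { isPreorder = record
      { isEquivalence = isEquivalence
      ; reflexive = λ f≈g → trans (∨-cong f≈g refl) (∨-idem _)
      ; trans = λ {f} {g} {h} f≤g g≤h → trans (∨-cong refl (sym g≤h))
          (trans (sym (∨-assoc f g h)) (trans (∨-cong f≤g refl) g≤h))
      }
    ; antisym = λ {f} {g} f≤g g≤f → trans (sym g≤f) (trans (∨-comm g f) f≤g)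
    }

  +-monoʳ : ∀ h {f g} → f ≤ g → (h + f) ≤ (h + g)
  +-monoʳ h f≤g = trans (∨-cong (+-comm h _) (+-comm h _))
    (trans (IsRieszSpace.+-mono isRieszSpace h f≤g) (+-comm _ h))

  open OrderedAbelianGroup +-abelianGroup ≤-isPartialOrder +-monoʳ public

  ∨-upperˡ : ∀ f g → f ≤ (f ∨ g)
  ∨-upperˡ f g = trans (sym (∨-assoc f f g)) (∨-cong (∨-idem f) refl)

  ∨-upperʳ : ∀ f g → g ≤ (f ∨ g)
  ∨-upperʳ f g = ≤-respʳ-≈ (∨-comm g f) (∨-upperˡ g f)

  ∨-least : ∀ {f g h} → f ≤ h → g ≤ h → (f ∨ g) ≤ h
  ∨-least {f} {g} {h} f≤h g≤h =
    trans (∨-assoc f g h) (trans (∨-cong refl g≤h) f≤h)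

  ∧-lowerˡ : ∀ f g → (f ∧ g) ≤ f
  ∧-lowerˡ f g = trans (∨-comm _ f) (∨-absorbs-∧ f g)

  ∧-lowerʳ : ∀ f g → (f ∧ g) ≤ g
  ∧-lowerʳ f g = ≤-respˡ-≈ (∧-comm g f) (∧-lowerˡ g f)

  ≤⇒∧≈ : ∀ {f g} → f ≤ g → (f ∧ g) ≈ f
  ≤⇒∧≈ {f} {g} f≤g = trans (∧-cong refl (sym f≤g)) (∧-absorbs-∨ f g)

  ∧-greatest : ∀ {f g h} → h ≤ f → h ≤ g → h ≤ (f ∧ g)
  ∧-greatest {f} {g} {h} h≤f h≤g =
    ≤-respˡ-≈ (trans (sym (∧-assoc h f g)) (trans (∧-cong (≤⇒∧≈ h≤f) refl) (≤⇒∧≈ h≤g)))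
      (∧-lowerʳ h (f ∧ g))

  ∧-mono : ∀ {f f′ g g′} → f ≤ f′ → g ≤ g′ → (f ∧ g) ≤ (f′ ∧ g′)
  ∧-mono f≤f′ g≤g′ = ∧-greatest
    (≤-trans (∧-lowerˡ _ _) f≤f′) (≤-trans (∧-lowerʳ _ _) g≤g′)

  0≤⁺ : ∀ f → 0# ≤ f ⁺
  0≤⁺ f = ∨-upperʳ f 0#

  ≤⁺ : ∀ f → f ≤ f ⁺
  ≤⁺ f = ∨-upperˡ f 0#

  ⁺-idem : ∀ {f} → 0# ≤ f → f ⁺ ≈ f
  ⁺-idem {f} 0≤f = ≤-antisym (∨-least ≤-refl 0≤f) (≤⁺ f)

  -- Put `z = p ∧ (f + g)`. Then `z - f` is below `p` and `g`, hence below `p ∧ g`; therefore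
  -- `z - (p ∧ g)` is below `f`, and it is below `p` because `p ∧ g` is positive.
  ∧-subadditive : ∀ {p f g} → 0# ≤ p → 0# ≤ f → 0# ≤ g →
                  (p ∧ (f + g)) ≤ ((p ∧ f) + (p ∧ g))
  ∧-subadditive {p} {f} {g} 0≤p 0≤f 0≤g =
    linear z-w≤p∧f
      (solve 3 (λ z a b → z ⊕ ⊖ (a ⊕ b) ⊜ (z ⊕ ⊖ b) ⊕ ⊖ a) ≡.refl z (p ∧ f) (p ∧ g))
    where
    z = p ∧ (f + g)
    z-f≤p∧g : (z - f) ≤ (p ∧ g)
    z-f≤p∧g = ∧-greatest
      (linear (+-mono (∧-lowerˡ p (f + g)) 0≤f)
        (solve 3 (λ z p f → (z ⊕ ⊖ f) ⊕ ⊖ p ⊜ (z ⊕ 𝟘) ⊕ ⊖ (p ⊕ f)) ≡.refl z p f))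
      (linear (∧-lowerʳ p (f + g))
        (solve 3 (λ z f g → (z ⊕ ⊖ f) ⊕ ⊖ g ⊜ z ⊕ ⊖ (f ⊕ g)) ≡.refl z f g))
    z-w≤p∧f : (z - (p ∧ g)) ≤ (p ∧ f)
    z-w≤p∧f = ∧-greatest
      (linear (+-mono (∧-lowerˡ p (f + g)) (∧-greatest 0≤p 0≤g))
        (solve 3 (λ z p w → (z ⊕ ⊖ w) ⊕ ⊖ p ⊜ (z ⊕ 𝟘) ⊕ ⊖ (p ⊕ w)) ≡.refl z p (p ∧ g)))
      (linear z-f≤p∧g
        (solve 3 (λ z f w → (z ⊕ ⊖ w) ⊕ ⊖ f ⊜ (z ⊕ ⊖ f) ⊕ ⊖ w) ≡.refl z f (p ∧ g)))

  -- `f ⁺ - z` is an upper bound of both `f` and `0#`, so it dominates `f ⁺`.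
  ⁺-disjoint : ∀ {f g z} → f ≤ (f ⁺ - g) → z ≤ f ⁺ → z ≤ g → z ≤ 0#
  ⁺-disjoint {f} {g} {z} f≤ z≤f⁺ z≤g = a≤a-b⇒b≤0 (∨-least
    (≤-trans f≤ (+-mono ≤-refl (neg-anti z≤g))) (sub-nonNeg z≤f⁺))

  differences-disjoint : ∀ f g → ((f - g) ⁺ ∧ (g - f) ⁺) ≤ 0#
  differences-disjoint f g = ⁺-disjoint
    (linear (∨-least g-f≤ x≥0)
      (solve 4 (λ f g x y → (f ⊕ ⊖ g) ⊕ ⊖ (x ⊕ ⊖ y) ⊜ y ⊕ ⊖ ((g ⊕ ⊖ f) ⊕ x))
        ≡.refl f g x ((g - f) ⁺)))
    (∧-lowerˡ _ _) (∧-lowerʳ _ _)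
    where
    x = (f - g) ⁺
    g-f≤ : (g - f) ≤ ((g - f) + x)
    g-f≤ = a≤a+b (0≤⁺ _)
    x≥0 : 0# ≤ ((g - f) + x)
    x≥0 = linear (≤⁺ (f - g))
      (solve 3 (λ f g x → 𝟘 ⊕ ⊖ ((g ⊕ ⊖ f) ⊕ x) ⊜ (f ⊕ ⊖ g) ⊕ ⊖ x) ≡.refl f g x)

  ≤+⁺ : ∀ f g → f ≤ (g + (f - g) ⁺)
  ≤+⁺ f g = linear (≤⁺ (f - g))
    (solve 3 (λ f g x → f ⊕ ⊖ (g ⊕ x) ⊜ (f ⊕ ⊖ g) ⊕ ⊖ x) ≡.refl f g ((f - g) ⁺))

  ⁻-nonNeg : ∀ f → 0# ≤ f ⁻
  ⁻-nonNeg f = linear (∧-lowerʳ f 0#)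
    (solve 1 (λ a → 𝟘 ⊕ ⊖ ⊖ a ⊜ a ⊕ ⊖ 𝟘) ≡.refl (f ∧ 0#))

  ⁺-⁻ : ∀ f → f ⁺ - f ⁻ ≈ f
  ⁺-⁻ f = ≤-antisym
    (linear (∨-least (a≤a+b (⁻-nonNeg f)) 0≤f+f⁻)
      (solve 3 (λ a f b → (a ⊕ ⊖ b) ⊕ ⊖ f ⊜ a ⊕ ⊖ (f ⊕ b)) ≡.refl (f ⁺) f (f ⁻)))
    (linear (∧-greatest f-f⁺≤f f-f⁺≤0)
      (solve 3 (λ f a b → f ⊕ ⊖ (a ⊕ ⊖ ⊖ b) ⊜ (f ⊕ ⊖ a) ⊕ ⊖ b) ≡.refl f (f ⁺) (f ∧ 0#)))
    where
    0≤f+f⁻ : 0# ≤ (f + f ⁻)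
    0≤f+f⁻ = linear (∧-lowerˡ f 0#)
      (solve 2 (λ f b → 𝟘 ⊕ ⊖ (f ⊕ ⊖ b) ⊜ b ⊕ ⊖ f) ≡.refl f (f ∧ 0#))
    f-f⁺≤f : (f - f ⁺) ≤ f
    f-f⁺≤f = linear (0≤⁺ f)
      (solve 2 (λ f a → (f ⊕ ⊖ a) ⊕ ⊖ f ⊜ 𝟘 ⊕ ⊖ a) ≡.refl f (f ⁺))
    f-f⁺≤0 : (f - f ⁺) ≤ 0#
    f-f⁺≤0 = linear (≤⁺ f)
      (solve 2 (λ f a → (f ⊕ ⊖ a) ⊕ ⊖ 𝟘 ⊜ f ⊕ ⊖ a) ≡.refl f (f ⁺))

  ⁺∧⁻ : ∀ f → (f ⁺ ∧ f ⁻) ≤ 0#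
  ⁺∧⁻ f = ⁺-disjoint (≤-reflexive (sym (⁺-⁻ f))) (∧-lowerˡ _ _) (∧-lowerʳ _ _)

  open RingProperties ℝ.ring using (-1*x≈-x)

  -·≈neg· : ∀ a f → (ℝ.- a) · f ≈ neg (a · f)
  -·≈neg· a f = trans (·-cong (ℝ.sym (-1*x≈-x a)) refl) (·-assoc _ a f)

  ·neg≈neg· : ∀ a f → a · neg f ≈ neg (a · f)
  ·neg≈neg· a f = trans (sym (·-assoc a _ f))
    (trans (·-cong (ℝ.*-comm a _) refl) (·-assoc _ a f))

  ·-monoʳ : ∀ {a f g} → ℝ.0# ℝ.≤ a → f ≤ g → (a · f) ≤ (a · g)
  ·-monoʳ {a} {f} {g} 0≤a f≤g = linear (·-nonNegative 0≤a (sub-nonNeg f≤g))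
    (trans (solve 2 (λ f g → f ⊕ ⊖ g ⊜ 𝟘 ⊕ ⊖ (g ⊕ ⊖ f)) ≡.refl (a · f) (a · g))
      (+-cong refl (neg-cong
        (trans (+-cong refl (sym (·neg≈neg· a f))) (sym (·-distribˡ a g (neg f)))))))

  -- If `g` bounds the sequence, meeting its members with `g` changes nothing, so `⋎ g f` is their
  -- supremum.
  ⋎-supremum⇒complete :
    (∀ g f → IsSupremum _≤_ (Range _≈_ λ n → f n ∧ g) (⋎ g f)) → IsDedekindσComplete ℝ G
  ⋎-supremum⇒complete ⋎-sup f (g , f≤g) = ⋎ g f ,
    (λ x (n , x≈) → proj₁ (⋎-sup g f) x (n , trans x≈ (f≈f∧g n))) ,
    (λ u f≤u → proj₂ (⋎-sup g f) u λ x (n , x≈) → f≤u x (n , trans x≈ (sym (f≈f∧g n))))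
    where
    f≈f∧g : ∀ n → f n ≈ f n ∧ g
    f≈f∧g n = sym (≤⇒∧≈ (f≤g (f n) (n , refl)))

-- Truncated Riesz spaces and the equational forms of (T4) and (T5)

module TruncatedRieszSpace {ℓ : Level} (ℝ : CompleteOrderedField ℓ) (G : σAlgebra ℝ)
  (isTruncatedRieszSpace : IsDedekindσCompleteTruncatedRieszSpace ℝ G) where

  open IsDedekindσCompleteTruncatedRieszSpace isTruncatedRieszSpace public
    using (isRieszSpace; isDedekindσComplete; ⋎-isSupremum)
  open IsTruncation
    (IsDedekindσCompleteTruncatedRieszSpace.isTruncation isTruncatedRieszSpace) public
  open RieszSpace ℝ G isRieszSpace public

  archimedean : ∀ {f g} → (∀ n → n ×ℕ f ≤ g) → f ≤ 0#
  archimedean {f} {g} nf≤g = multiples-supremum⇒≤0 (proj₂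
    (isDedekindσComplete (_×ℕ f) (g , λ x (n , x≈) → ≤-respˡ-≈ (sym x≈) (nf≤g n))))

  ⋎-upper : ∀ g f n → f n ∧ g ≤ ⋎ g f
  ⋎-upper g f n = proj₁ (⋎-isSupremum g f) _ (n , refl)

  ⋎-least : ∀ {g f u} → (∀ n → f n ∧ g ≤ u) → ⋎ g f ≤ u
  ⋎-least f∧g≤u = proj₂ (⋎-isSupremum _ _) _
    λ x (n , x≈) → ≤-respˡ-≈ (sym x≈) (f∧g≤u n)

  ⋎-≤ : ∀ g f → ⋎ g f ≤ g
  ⋎-≤ g f = ⋎-least λ n → ∧-lowerʳ (f n) g

  disjoint-× : ∀ n {p f} → 0# ≤ p → 0# ≤ f → p ∧ f ≤ 0# → p ∧ (n ×ℕ f) ≤ 0#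
  disjoint-× zero    0≤p 0≤f p∧f≤0 = ∧-lowerʳ _ _
  disjoint-× (suc n) 0≤p 0≤f p∧f≤0 =
    ≤-trans (∧-subadditive 0≤p 0≤f (×-nonNeg n 0≤f))
      (≤-respʳ-≈ (+-identityˡ 0#) (+-mono p∧f≤0 (disjoint-× n 0≤p 0≤f p∧f≤0)))

  -- The element `u` dominates what `f` has in the band of `x`. If `z` is the meet in question,
  -- `(n ×ℕ x) ∧ f + z` is still below `(suc n ×ℕ x) ∧ f`, so the supremum of these meets leaves a
  -- gap of `z`.
  band-remainder-disjoint : ∀ {f x u} → 0# ≤ f → 0# ≤ x →
    (∀ n → (n ×ℕ x) ∧ f ≤ u) → (f - u) ∧ x ≤ 0#
  band-remainder-disjoint {f} {x} {u} 0≤f 0≤x nx∧f≤u =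
    supremum-gap (⋎-isSupremum f (_×ℕ x)) λ n →
      linear (≤-trans (∧-greatest (nx∧f+z≤sx n) (nx∧f+z≤f n)) (⋎-upper f _ (suc n)))
        (solve 3 (λ a s z → a ⊕ ⊖ (s ⊕ ⊖ z) ⊜ (a ⊕ z) ⊕ ⊖ s) ≡.refl ((n ×ℕ x) ∧ f) (⋎ f (_×ℕ x)) z)
    where
    z = (f - u) ∧ x
    nx∧f+z≤sx : ∀ n → (n ×ℕ x) ∧ f + z ≤ suc n ×ℕ x
    nx∧f+z≤sx n = ≤-respʳ-≈ (+-comm _ _) (+-mono (∧-lowerˡ _ f) (∧-lowerʳ _ x))
    nx∧f+z≤f : ∀ n → (n ×ℕ x) ∧ f + z ≤ f
    nx∧f+z≤f n = linear (+-mono (nx∧f≤u n) (∧-lowerˡ (f - u) x))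
      (solve 4 (λ a z f u → (a ⊕ z) ⊕ ⊖ f ⊜ (a ⊕ z) ⊕ ⊖ (u ⊕ (f ⊕ ⊖ u))) ≡.refl
        ((n ×ℕ x) ∧ f) z f u)

  trunc-mono : ∀ {f g} → 0# ≤ f → f ≤ g → trunc f ≤ trunc g
  trunc-mono 0≤f f≤g = ≤-trans
    (∧-greatest (≤-trans (T3ʳ _ 0≤f) f≤g) ≤-refl) (T3ˡ _ _ (≤-trans 0≤f f≤g) 0≤f)

  -- In ℝ this is the positive part of `f - 1`.
  excess : Carrier → Carrier
  excess f = f - trunc f

  excess-nonNeg : ∀ {f} → 0# ≤ f → 0# ≤ excess f
  excess-nonNeg 0≤f = sub-nonNeg (T3ʳ _ 0≤f)

  excess-≤ : ∀ {f} → 0# ≤ f → excess f ≤ f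
  excess-≤ {f} 0≤f = linear (T2 f 0≤f)
    (solve 2 (λ f t → (f ⊕ ⊖ t) ⊕ ⊖ f ⊜ 𝟘 ⊕ ⊖ t) ≡.refl f (trunc f))

  -- The claim amounts to `trunc g - (g - f) ≤ trunc f`. The positive part `w` of the left side is
  -- below both `f` and `trunc g`, and `T3ˡ` applies.
  excess-mono : ∀ {f g} → 0# ≤ f → f ≤ g → excess f ≤ excess g
  excess-mono {f} {g} 0≤f f≤g = linear (≤-trans (≤⁺ _) w≤trunc-f)
    (solve 4 (λ f g s t → (f ⊕ ⊖ s) ⊕ ⊖ (g ⊕ ⊖ t) ⊜ (t ⊕ ⊖ (g ⊕ ⊖ f)) ⊕ ⊖ s) ≡.refl
      f g (trunc f) (trunc g))
    where
    0≤g = ≤-trans 0≤f f≤g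
    w = (trunc g - (g - f)) ⁺
    w≤f : w ≤ f
    w≤f = ∨-least (linear (T3ʳ g 0≤g)
      (solve 3 (λ f g t → (t ⊕ ⊖ (g ⊕ ⊖ f)) ⊕ ⊖ f ⊜ t ⊕ ⊖ g) ≡.refl f g (trunc g))) 0≤f
    w≤trunc-g : w ≤ trunc g
    w≤trunc-g = ∨-least (linear f≤g
      (solve 3 (λ f g t → (t ⊕ ⊖ (g ⊕ ⊖ f)) ⊕ ⊖ t ⊜ f ⊕ ⊖ g) ≡.refl f g (trunc g))) (T2 g 0≤g)
    w≤trunc-f : w ≤ trunc f
    w≤trunc-f = ≤-trans (∧-greatest w≤f w≤trunc-g) (T3ˡ f g 0≤f 0≤g)

  -- As `trunc (f + g)` is below `f + g`, it is at most the sum of its meets with `f` and with `g`;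
  -- `T3ˡ` bounds each of them.
  trunc-subadditive : ∀ {f g} → 0# ≤ f → 0# ≤ g → trunc (f + g) ≤ trunc f + trunc g
  trunc-subadditive {f} {g} 0≤f 0≤g =
    ≤-trans (∧-greatest ≤-refl (T3ʳ _ 0≤f+g))
    (≤-trans (∧-subadditive (T2 _ 0≤f+g) 0≤f 0≤g) (+-mono (below f 0≤f) (below g 0≤g)))
    where
    0≤f+g = +-nonNeg 0≤f 0≤g
    below : ∀ h → 0# ≤ h → trunc (f + g) ∧ h ≤ trunc h
    below h 0≤h = ≤-respˡ-≈ (∧-comm h _) (T3ˡ h _ 0≤h 0≤f+g)

  trunc-× : ∀ n {f} → 0# ≤ f → trunc (n ×ℕ f) ≤ n ×ℕ trunc f
  trunc-× zero    0≤f = T3ʳ 0# ≤-refl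
  trunc-× (suc n) 0≤f = ≤-trans
    (trunc-subadditive 0≤f (×-nonNeg n 0≤f)) (+-mono ≤-refl (trunc-× n 0≤f))

  ×-excess : ∀ m {f} → 0# ≤ f → m ×ℕ excess f ≤ excess (m ×ℕ f)
  ×-excess m {f} 0≤f = ≤-respˡ-≈
    (sym (trans (×-distrib-+ f _ m) (+-cong refl (×-neg m (trunc f)))))
    (+-mono ≤-refl (neg-anti (trunc-× m 0≤f)))

  difference-zero : ∀ {f u} → (f - u ≈ 0#) → f ≈ u
  difference-zero {f} {u} f-u≈0 = trans
    (solve 2 (λ f u → f ⊜ (f ⊕ ⊖ u) ⊕ u) ≡.refl f u)
    (trans (+-cong f-u≈0 refl) (+-identityˡ u))

  -- The remainder `d` is disjoint from `trunc f`, while `trunc d` is below both of them. So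
  -- `trunc d` vanishes, and `d` vanishes by `T4`.
  T4-⋎ : ∀ f → 0# ≤ f → ⋎ f (λ n → n ×ℕ trunc f) ≈ f
  T4-⋎ f 0≤f = sym (difference-zero (T4 d 0≤d (≤-antisym trunc-d≤0 (T2 d 0≤d))))
    where
    u = ⋎ f (λ n → n ×ℕ trunc f)
    d = f - u
    0≤d = sub-nonNeg (⋎-≤ f (λ n → n ×ℕ trunc f))
    0≤u = ≤-trans (∧-greatest ≤-refl 0≤f) (⋎-upper f (λ n → n ×ℕ trunc f) 0)
    d≤f : d ≤ f
    d≤f = linear 0≤u (solve 2 (λ f u → (f ⊕ ⊖ u) ⊕ ⊖ f ⊜ 𝟘 ⊕ ⊖ u) ≡.refl f u)
    trunc-d≤0 : trunc d ≤ 0#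
    trunc-d≤0 = ≤-trans (∧-greatest (T3ʳ d 0≤d) (trunc-mono 0≤d d≤f))
      (band-remainder-disjoint 0≤f (T2 f 0≤f) (⋎-upper f (λ n → n ×ℕ trunc f)))

  -- The remainder `d` is disjoint from every `y k`, and so is `k ×ℕ d`. But `excess (k ×ℕ d)` is
  -- below both `y k` and `k ×ℕ d`; hence truncation fixes all multiples of `d`, and `T5` applies.
  T5-⋎ : ∀ f → 0# ≤ f → ⋎ f (λ n → excess (n ×ℕ f)) ≈ f
  T5-⋎ f 0≤f = sym (difference-zero (T5 d 0≤d λ k → difference-zero
      (≤-antisym (excess≤0 k) (excess-nonNeg (×-nonNeg k 0≤d)))))
    where
    y : ℕ → Carrier
    y n = excess (n ×ℕ f)
    0≤y : ∀ n → 0# ≤ y n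
    0≤y n = excess-nonNeg (×-nonNeg n 0≤f)
    u = ⋎ f y
    d = f - u
    0≤d = sub-nonNeg (⋎-≤ f y)
    0≤u = ≤-trans (∧-greatest (0≤y 0) 0≤f) (⋎-upper f y 0)
    d≤f : d ≤ f
    d≤f = linear 0≤u (solve 2 (λ f u → (f ⊕ ⊖ u) ⊕ ⊖ f ⊜ 𝟘 ⊕ ⊖ u) ≡.refl f u)
    -- `m ×ℕ y n` is at most `y (m ℕ.* n)`, so `u`, defined from the `y n` alone, also bounds their
    -- multiples.
    my∧f≤u : ∀ n m → (m ×ℕ y n) ∧ f ≤ u
    my∧f≤u n m = ≤-trans
      (∧-mono (≤-respʳ-≈ (+-cong (×-assocˡ f m n) (neg-cong (trunc-cong (×-assocˡ f m n))))
        (×-excess m (×-nonNeg n 0≤f))) ≤-refl)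
      (⋎-upper f y (m ℕ.* n))
    excess≤0 : ∀ k → excess (k ×ℕ d) ≤ 0#
    excess≤0 k = ≤-trans
      (∧-greatest (excess-mono (×-nonNeg k 0≤d) (×-mono k d≤f)) (excess-≤ (×-nonNeg k 0≤d)))
      (disjoint-× k (0≤y k) 0≤d
        (≤-respˡ-≈ (∧-comm d _) (band-remainder-disjoint 0≤f (0≤y k) (my∧f≤u k))))

-- Infinitary terms, equations and equational classes

module Terms {ℓ : Level} (ℝ : CompleteOrderedField ℓ) where

  private module ℝ = CompleteOrderedField ℝ

  infixl 6 _⊞_ _⊻_
  infixr 8 _⊡_

  -- The variables are natural numbers in the laws, where countably many suffice, and the elements
  -- of an algebra in the proof of generation.
  data Term {v} (V : Set v) : Set (v ⊔ˡ ℓ) where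
    var : V → Term V
    𝟎   : Term V
    _⊞_ : Term V → Term V → Term V
    _⊻_ : Term V → Term V → Term V
    _⊡_ : ℝ.Carrier → Term V → Term V
    sup : Term V → (ℕ → Term V) → Term V
    cut : Term V → Term V

  module _ {v : Level} {V : Set v} where

    infixl 7 _⊼_
    infixr 8 ⊟_ _⊠_

    ⊟_ : Term V → Term V
    ⊟ t = (ℝ.- ℝ.1#) ⊡ t

    _⊼_ : Term V → Term V → Term V
    s ⊼ t = ⊟ (⊟ s ⊻ ⊟ t)

    _⊠_ : ℕ → Term V → Term V
    zero  ⊠ t = 𝟎
    suc n ⊠ t = t ⊞ n ⊠ t

    eval : (A : σAlgebra ℝ) → (V → σAlgebra.Carrier A) → Term V → σAlgebra.Carrier A
    eval A ρ (var x)   = ρ x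
    eval A ρ 𝟎         = σAlgebra.0# A
    eval A ρ (s ⊞ t)   = σAlgebra._+_ A (eval A ρ s) (eval A ρ t)
    eval A ρ (s ⊻ t)   = σAlgebra._∨_ A (eval A ρ s) (eval A ρ t)
    eval A ρ (a ⊡ t)   = σAlgebra._·_ A a (eval A ρ t)
    eval A ρ (sup t s) = σAlgebra.⋎ A (eval A ρ t) (λ n → eval A ρ (s n))
    eval A ρ (cut t)   = σAlgebra.trunc A (eval A ρ t)

    eval-⊠ : ∀ A ρ n t → eval A ρ (n ⊠ t) ≡ σAlgebra._×ℕ_ A n (eval A ρ t)
    eval-⊠ A ρ zero    t = ≡.refl
    eval-⊠ A ρ (suc n) t = ≡.cong (σAlgebra._+_ A (eval A ρ t)) (eval-⊠ A ρ n t)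

    module _ (A : σAlgebra ℝ) where
      open σAlgebra A using (_≈_; +-cong; ∨-cong; ·-cong; ⋎-cong; trunc-cong; isEquivalence)
      open IsEquivalence isEquivalence

      eval-cong : ∀ {ρ ρ′} → (∀ x → ρ x ≈ ρ′ x) → ∀ t → eval A ρ t ≈ eval A ρ′ t
      eval-cong ρ≈ (var x)   = ρ≈ x
      eval-cong ρ≈ 𝟎         = refl
      eval-cong ρ≈ (s ⊞ t)   = +-cong (eval-cong ρ≈ s) (eval-cong ρ≈ t)
      eval-cong ρ≈ (s ⊻ t)   = ∨-cong (eval-cong ρ≈ s) (eval-cong ρ≈ t)
      eval-cong ρ≈ (a ⊡ t)   = ·-cong ℝ.refl (eval-cong ρ≈ t)
      eval-cong ρ≈ (sup t s) = ⋎-cong (eval-cong ρ≈ t) (λ n → eval-cong ρ≈ (s n))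
      eval-cong ρ≈ (cut t)   = trunc-cong (eval-cong ρ≈ t)

    module _ {A B : σAlgebra ℝ} {h} (h-homo : IsHomomorphism ℝ A B h) where
      open σAlgebra B using (_≈_; +-cong; ∨-cong; ·-cong; ⋎-cong; trunc-cong; isEquivalence)
      open IsEquivalence isEquivalence
      open IsHomomorphism h-homo

      eval-homo : ∀ ρ t → h (eval A ρ t) ≈ eval B (h ∘ ρ) t
      eval-homo ρ (var x)   = refl
      eval-homo ρ 𝟎         = 0#-homo
      eval-homo ρ (s ⊞ t)   = trans (+-homo _ _) (+-cong (eval-homo ρ s) (eval-homo ρ t))
      eval-homo ρ (s ⊻ t)   = trans (∨-homo _ _) (∨-cong (eval-homo ρ s) (eval-homo ρ t))
      eval-homo ρ (a ⊡ t)   = trans (·-homo _ _) (·-cong ℝ.refl (eval-homo ρ t))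
      eval-homo ρ (sup t s) = trans (⋎-homo _ _)
        (⋎-cong (eval-homo ρ t) (λ n → eval-homo ρ (s n)))
      eval-homo ρ (cut t)   = trans (trunc-homo _) (trunc-cong (eval-homo ρ t))

  Equation : Set ℓ
  Equation = Term ℕ × Term ℕ

  _⊨_ : σAlgebra ℝ → Equation → Set ℓ
  A ⊨ (s , t) = ∀ ρ → σAlgebra._≈_ A (eval A ρ s) (eval A ρ t)

  ⊨-image : ∀ {A B h} → IsHomomorphism ℝ A B h → (∀ y → ∃ λ x → σAlgebra._≈_ B (h x) y) →
            ∀ e → A ⊨ e → B ⊨ e
  ⊨-image {A} {B} {h} h-homo surj (s , t) A⊨e ρ = trans (sym (via s))
    (trans (IsHomomorphism.cong h-homo (A⊨e preimage)) (via t))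
    where
    open IsEquivalence (σAlgebra.isEquivalence B)
    preimage : ℕ → σAlgebra.Carrier A
    preimage n = proj₁ (surj (ρ n))
    via : ∀ t → σAlgebra._≈_ B (h (eval A preimage t)) (eval B ρ t)
    via t = trans (eval-homo h-homo preimage t)
      (eval-cong B (λ n → proj₂ (surj (ρ n))) t)

  -- Jointly injective families of homomorphisms cover products, through the projections, as well as
  -- subalgebras, through a single embedding.
  ⊨-reflected : ∀ {i} {I : Set i} (A : σAlgebra ℝ) (B : I → σAlgebra ℝ) {h : ∀ i → _} →
    (∀ i → IsHomomorphism ℝ A (B i) (h i)) →
    (∀ {x y} → (∀ i → σAlgebra._≈_ (B i) (h i x) (h i y)) → σAlgebra._≈_ A x y) →
    ∀ e → (∀ i → B i ⊨ e) → A ⊨ e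
  ⊨-reflected A B {h} h-homo inj (s , t) B⊨e ρ = inj λ i →
    let open IsEquivalence (σAlgebra.isEquivalence (B i)) in
    trans (eval-homo (h-homo i) ρ s)
      (trans (B⊨e i (λ n → h i (ρ n))) (sym (eval-homo (h-homo i) ρ t)))

  record EquationalClass {κ} (K : Pred (σAlgebra ℝ) κ) : Set (κ ⊔ˡ Level.suc ℓ) where
    field
      Law    : Set ℓ
      law    : Law → Equation
      sound  : ∀ {A} → K A → ∀ l → A ⊨ law l
      models : ∀ {A} → (∀ l → A ⊨ law l) → K A

  equational⇒closed : ∀ {κ} {K : Pred (σAlgebra ℝ) κ} → EquationalClass K → ClosedUnderHSP ℝ K
  equational⇒closed E = record
    { products = λ I A K-A → models λ l → ⊨-reflected (∏ ℝ I A) A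
        (λ i → record
          { cong = λ p → p i
          ; 0#-homo = refl (A i) ; +-homo = λ _ _ → refl (A i) ; ∨-homo = λ _ _ → refl (A i)
          ; ·-homo = λ _ _ → refl (A i) ; ⋎-homo = λ _ _ → refl (A i)
          ; trunc-homo = λ _ → refl (A i) })
        (λ p → p) (law l) (λ i → sound (K-A i) l)
    ; subalgebras = λ A B (h , h-homo , inj) K-B → models λ l →
        ⊨-reflected {I = ⊤} A (λ _ → B) (λ _ → h-homo) (λ p → inj (p tt)) (law l) (λ _ → sound K-B l)
    ; images = λ A B (h , h-homo , surj) K-A → models λ l →
        ⊨-image h-homo surj (law l) (sound K-A l)
    }
    where
    open EquationalClass E
    refl : ∀ A {x} → σAlgebra._≈_ A x x
    refl A = IsEquivalence.refl (σAlgebra.isEquivalence A)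

-- Equational axiomatisation

module Axioms {ℓ : Level} (ℝ : CompleteOrderedField ℓ) where

  private module ℝ = CompleteOrderedField ℝ
  open Terms ℝ

  data Law : Set ℓ where
    +-assoc +-comm +-identityˡ +-inverseʳ : Law
    ·-distribˡ ·-zeroʳ                    : ℝ.Carrier → Law
    ·-distribʳ ·-assoc                    : ℝ.Carrier → ℝ.Carrier → Law
    ·-identityˡ ·-zeroˡ                   : Law
    ∨-comm ∨-assoc ∨-absorbs-∧ ∧-absorbs-∨ : Law
    +-mono                                : Law
    ·-nonNegative                         : ∀ a → ℝ.0# ℝ.≤ a → Law
    ⋎-upper                               : ℕ → Law
    ⋎-bounded ⋎-∧                         : Law
    T1 T2 T3ˡ T3ʳ T4-⋎ T5-⋎               : Law

  private
    x y z x⁺ y⁺ : Term ℕ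
    x  = var 0
    y  = var 1
    z  = var 2
    x⁺ = x ⊻ 𝟎
    y⁺ = y ⊻ 𝟎

    -- A sequence argument is spread over the variables from 3 on.
    s : ℕ → Term ℕ
    s n = var (3 ℕ.+ n)

    infix 4 _⊑_
    _⊑_ : Term ℕ → Term ℕ → Equation
    t ⊑ t′ = t ⊻ t′ , t′

  -- Conditional axioms become equations by substitution: `x⁺` stands for an arbitrary positive
  -- element, `x ⊻ y` for an arbitrary element above `x`. The sign condition on a scalar is part of
  -- the index of its law.
  law : Law → Equation
  law +-assoc             = (x ⊞ y) ⊞ z , x ⊞ (y ⊞ z)
  law +-comm              = x ⊞ y , y ⊞ x
  law +-identityˡ         = 𝟎 ⊞ x , x
  law +-inverseʳ          = x ⊞ ⊟ x , 𝟎
  law (·-distribˡ a)      = a ⊡ (x ⊞ y) , (a ⊡ x) ⊞ (a ⊡ y)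
  law (·-zeroʳ a)         = a ⊡ 𝟎 , 𝟎
  law (·-distribʳ a b)    = (a ℝ.+ b) ⊡ x , (a ⊡ x) ⊞ (b ⊡ x)
  law (·-assoc a b)       = (a ℝ.* b) ⊡ x , a ⊡ (b ⊡ x)
  law ·-identityˡ         = ℝ.1# ⊡ x , x
  law ·-zeroˡ             = ℝ.0# ⊡ x , 𝟎
  law ∨-comm              = x ⊻ y , y ⊻ x
  law ∨-assoc             = (x ⊻ y) ⊻ z , x ⊻ (y ⊻ z)
  law ∨-absorbs-∧         = x ⊻ (x ⊼ y) , x
  law ∧-absorbs-∨         = x ⊼ (x ⊻ y) , x
  law +-mono              = x ⊞ z ⊑ (x ⊻ y) ⊞ z
  law (·-nonNegative a _) = 𝟎 ⊑ a ⊡ x⁺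
  law (⋎-upper n)         = s n ⊼ x ⊑ sup x s
  law ⋎-bounded           = sup x (λ n → s n ⊼ y) ⊑ y
  law ⋎-∧                 = sup x (λ n → s n ⊼ x) , sup x s
  law T1                  = cut x , cut x⁺ ⊞ ⊟ ⊟ (x ⊼ 𝟎)
  law T2                  = 𝟎 ⊑ cut x⁺
  law T3ˡ                 = x⁺ ⊼ cut y⁺ ⊑ cut x⁺
  law T3ʳ                 = cut x⁺ ⊑ x⁺
  law T4-⋎                = sup x⁺ (λ n → n ⊠ cut x⁺) , x⁺
  law T5-⋎                = sup x⁺ (λ n → n ⊠ x⁺ ⊞ ⊟ cut (n ⊠ x⁺)) , x⁺

  module Sound {A : σAlgebra ℝ} (K-A : IsDedekindσCompleteTruncatedRieszSpace ℝ A) where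
    private module A = TruncatedRieszSpace ℝ A K-A

    sound : ∀ l → A ⊨ law l
    sound +-assoc             ρ = A.+-assoc _ _ _
    sound +-comm              ρ = A.+-comm _ _
    sound +-identityˡ         ρ = A.+-identityˡ _
    sound +-inverseʳ          ρ = A.+-inverseʳ _
    sound (·-distribˡ a)      ρ = A.·-distribˡ a _ _
    sound (·-zeroʳ a)         ρ = A.·-zeroʳ a
    sound (·-distribʳ a b)    ρ = A.·-distribʳ _ a b
    sound (·-assoc a b)       ρ = A.·-assoc a b _
    sound ·-identityˡ         ρ = A.·-identityˡ _
    sound ·-zeroˡ             ρ = A.·-zeroˡ _
    sound ∨-comm              ρ = A.∨-comm _ _
    sound ∨-assoc             ρ = A.∨-assoc _ _ _
    sound ∨-absorbs-∧         ρ = A.∨-absorbs-∧ _ _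
    sound ∧-absorbs-∨         ρ = A.∧-absorbs-∨ _ _
    sound +-mono              ρ = A.+-mono (A.∨-upperˡ _ _) A.≤-refl
    sound (·-nonNegative a p) ρ = A.·-nonNegative p (A.0≤⁺ _)
    sound (⋎-upper n)         ρ = A.⋎-upper _ _ n
    sound ⋎-bounded           ρ = A.⋎-least λ n →
      A.≤-trans (A.∧-lowerˡ _ _) (A.∧-lowerʳ _ _)
    sound ⋎-∧                 ρ = A.≤-antisym
      (A.⋎-least λ n → A.≤-trans (A.∧-lowerˡ _ _) (A.⋎-upper _ _ n))
      (A.⋎-least λ n → A.≤-trans (A.∧-greatest A.≤-refl (A.∧-lowerʳ _ _)) (A.⋎-upper _ _ n))
    sound T1                  ρ = A.T1 _
    sound T2                  ρ = A.T2 _ (A.0≤⁺ _)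
    sound T3ˡ                 ρ = A.T3ˡ _ _ (A.0≤⁺ _) (A.0≤⁺ _)
    sound T3ʳ                 ρ = A.T3ʳ _ (A.0≤⁺ _)
    sound T4-⋎                ρ = A.trans
      (A.⋎-cong A.refl λ n → reflexive (eval-⊠ A ρ n (cut x⁺)))
      (A.T4-⋎ _ (A.0≤⁺ _))
      where open IsEquivalence A.isEquivalence
    sound T5-⋎                ρ = A.trans
      (A.⋎-cong A.refl λ n → reflexive
        (≡.cong (λ f → f A.- A.trunc f) (eval-⊠ A ρ n x⁺)))
      (A.T5-⋎ _ (A.0≤⁺ _))
      where open IsEquivalence A.isEquivalence

  module Models {A : σAlgebra ℝ} (A⊨ : ∀ l → A ⊨ law l) where

    private
      module A = σAlgebra A
      open A hiding (+-cong; ∨-cong)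
      open IsEquivalence isEquivalence

      assign : Carrier → Carrier → Carrier → (ℕ → Carrier) → ℕ → Carrier
      assign f g h k 0 = f
      assign f g h k 1 = g
      assign f g h k 2 = h
      assign f g h k (suc (suc (suc n))) = k n

      -- For laws in `x`, `y` and `z` only; `const f` is a filler for the sequence variables.
      holds : ∀ l f g h →
        let ρ = assign f g h (const f) in eval A ρ (proj₁ (law l)) ≈ eval A ρ (proj₂ (law l))
      holds l f g h = A⊨ l (assign f g h (const f))

    isVectorSpace : IsLeftModule ℝ.ring _≈_ _+_ 0# neg _·_
    isVectorSpace = record
      { isLeftSemimodule = record
        { +ᴹ-isCommutativeMonoid = record
          { isMonoid = record
            { isSemigroup = record
              { isMagma = record { isEquivalence = isEquivalence ; ∙-cong = A.+-cong }
              ; assoc = holds +-assoc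
              }
            ; identity = +-idˡ , λ f → trans (+-commute f 0#) (+-idˡ f)
            }
          ; comm = +-commute
          }
        ; isPreleftSemimodule = record
          { *ₗ-cong = ·-cong
          ; *ₗ-zeroˡ = λ f → holds ·-zeroˡ f 0# 0#
          ; *ₗ-distribʳ = λ f a b → holds (·-distribʳ a b) f 0# 0#
          ; *ₗ-identityˡ = λ f → holds ·-identityˡ f 0# 0#
          ; *ₗ-assoc = λ a b f → holds (·-assoc a b) f 0# 0#
          ; *ₗ-zeroʳ = λ a → holds (·-zeroʳ a) 0# 0# 0#
          ; *ₗ-distribˡ = λ a f g → holds (·-distribˡ a) f g 0#
          }
        }
      ; -ᴹ‿cong = ·-cong ℝ.refl
      ; -ᴹ‿inverse = (λ f → trans (+-commute _ f) (+-inv f)) , +-inv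
      }
      where
      +-commute : ∀ f g → f + g ≈ g + f
      +-commute f g = holds +-comm f g 0#
      +-idˡ : ∀ f → 0# + f ≈ f
      +-idˡ f = holds +-identityˡ f 0# 0#
      +-inv : ∀ f → f - f ≈ 0#
      +-inv f = holds +-inverseʳ f 0# 0#

    isLattice : IsLattice _≈_ _∨_ _∧_
    isLattice = record
      { isEquivalence = isEquivalence
      ; ∨-comm = ∨-commute
      ; ∨-assoc = holds ∨-assoc
      ; ∨-cong = A.∨-cong
      ; ∧-comm = λ f g → neg-cong (∨-commute (neg f) (neg g))
      ; ∧-assoc = λ f g h → neg-cong
          (trans (A.∨-cong (neg-involutive _) refl)
          (trans (holds ∨-assoc (neg f) (neg g) (neg h))
                 (A.∨-cong refl (sym (neg-involutive _)))))
      ; ∧-cong = λ f≈ g≈ → neg-cong (A.∨-cong (neg-cong f≈) (neg-cong g≈))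
      ; absorptive = (λ f g → holds ∨-absorbs-∧ f g 0#) , (λ f g → holds ∧-absorbs-∨ f g 0#)
      }
      where
      neg-cong : ∀ {f g} → f ≈ g → neg f ≈ neg g
      neg-cong = ·-cong ℝ.refl
      neg-involutive : ∀ f → neg (neg f) ≈ f
      neg-involutive = AbelianGroupProperties.⁻¹-involutive
        (record { isAbelianGroup = IsLeftModule.+ᴹ-isAbelianGroup isVectorSpace })
      ∨-commute : ∀ f g → f ∨ g ≈ g ∨ f
      ∨-commute f g = holds ∨-comm f g 0#

    isRieszSpace : IsRieszSpace ℝ A
    isRieszSpace = record
      { isVectorSpace = isVectorSpace
      ; isLattice = isLattice
      ; +-mono = λ {f} {g} h f≤g →
          let eq = A.+-cong f≤g refl in
          trans (A.∨-cong refl (sym eq)) (trans (holds +-mono f g h) eq)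
      ; ·-nonNegative = λ {a} {f} 0≤a 0≤f →
          let eq = ·-cong ℝ.refl (trans (IsLattice.∨-comm isLattice f 0#) 0≤f) in
          trans (A.∨-cong refl (sym eq)) (trans (holds (·-nonNegative a 0≤a) f 0# 0#) eq)
      }

    private
      module R = RieszSpace ℝ A isRieszSpace

    ⋎-supremum : ∀ g f → IsSupremum _≤_ (Range _≈_ λ n → f n ∧ g) (⋎ g f)
    ⋎-supremum g f =
      (λ x (n , x≈) → R.≤-respˡ-≈ (sym x≈) (A⊨ (⋎-upper n) (assign g 0# 0# f))) ,
      -- Each `f n ∧ g` equals its meet with the upper bound `u`, so `⋎-bounded` applies to these
      -- elements; `⋎-∧` then removes the inner meet with `g`.
      λ u bound → R.≤-respˡ-≈
        (trans (⋎-cong refl λ n → R.≤⇒∧≈ (bound _ (n , refl))) (A⊨ ⋎-∧ (assign g 0# 0# f)))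
        (A⊨ ⋎-bounded (assign g u 0# (λ n → f n ∧ g)))

    isTruncation : IsTruncation ℝ A
    isTruncation = record
      { T1  = λ f → holds T1 f 0# 0#
      ; T2  = λ f 0≤f → R.≤-respʳ-≈ (trunc-cong (R.⁺-idem 0≤f)) (holds T2 f 0# 0#)
      ; T3ˡ = λ f g 0≤f 0≤g →
          R.≤-respˡ-≈ (R.∧-cong (R.⁺-idem 0≤f) (trunc-cong (R.⁺-idem 0≤g)))
          (R.≤-respʳ-≈ (trunc-cong (R.⁺-idem 0≤f)) (holds T3ˡ f g 0#))
      ; T3ʳ = λ f 0≤f →
          R.≤-respˡ-≈ (trunc-cong (R.⁺-idem 0≤f))
          (R.≤-respʳ-≈ (R.⁺-idem 0≤f) (holds T3ʳ f 0# 0#))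
      ; T4  = λ f 0≤f trunc-f≈0 → vanishes 0≤f (holds T4-⋎ f 0# 0#) λ n →
          trans (reflexive (eval-⊠ A _ n (cut x⁺)))
            (trans (R.×-congʳ n (trans (trunc-cong (R.⁺-idem 0≤f)) trunc-f≈0)) (R.×-zero n))
      ; T5  = λ f 0≤f nf≈ → vanishes 0≤f (holds T5-⋎ f 0# 0#) λ n →
          let eq = trans (reflexive (eval-⊠ A _ n x⁺)) (R.×-congʳ n (R.⁺-idem 0≤f)) in
          trans (A.+-cong (trans eq (nf≈ n)) (R.neg-cong (trunc-cong eq)))
            (R.+-inverseʳ _)
      }
      where
      vanishes : ∀ {f s} → 0# ≤ f → ⋎ (f ⁺) s ≈ f ⁺ → (∀ n → s n ≈ 0#) → f ≈ 0#
      vanishes {f} 0≤f eq s≈0 = R.≤-antisym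
        (R.≤-trans (R.≤⁺ f) (R.≤-respˡ-≈ eq (proj₂ (⋎-supremum _ _) 0# λ x (n , x≈) →
          R.≤-respˡ-≈ (sym x≈) (R.≤-trans (R.∧-lowerˡ _ _) (R.≤-reflexive (s≈0 n))))))
        0≤f

    truncatedRieszSpace : IsDedekindσCompleteTruncatedRieszSpace ℝ A
    truncatedRieszSpace = record
      { isRieszSpace = isRieszSpace
      ; isTruncation = isTruncation
      ; isDedekindσComplete = R.⋎-supremum⇒complete ⋎-supremum
      ; ⋎-isSupremum = ⋎-supremum
      }

  equationalClass : EquationalClass (IsDedekindσCompleteTruncatedRieszSpace ℝ)
  equationalClass = record
    { Law = Law
    ; law = law
    ; sound = Sound.sound
    ; models = Models.truncatedRieszSpace
    }

-- The reals as a truncated Riesz space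

module Reals {ℓ : Level} (ℝ : CompleteOrderedField ℓ) where

  open CompleteOrderedField ℝ public
    using (Carrier; _≈_; _≤_; _+_; _*_; -_; 0#; 1#; refl; sym; trans; total; complete
          ; inverse; 0#≉1#; *-nonNegative; _⊔_; _⊓_; *-cong; *-comm; *-assoc; *-identityˡ
          ; *-identityʳ; +-cong; +-comm; +-identityˡ; +-identityʳ; -‿cong; zeroˡ; zeroʳ; distribˡ
          ; -‿inverseʳ; ⊔-cong; ⊓-cong; sup⊓; sup⊓-isSupremum)
  open OrderedAbelianGroup (CompleteOrderedField.+-abelianGroup ℝ)
    (IsTotalOrder.isPartialOrder (CompleteOrderedField.isTotalOrder ℝ))
    (CompleteOrderedField.+-monoʳ-≤ ℝ) public
  open Max (CompleteOrderedField.totalOrder ℝ) public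
    using (x≤y⇒x⊔y≈y; x≤y⇒y⊔x≈y; ⊔-comm; ⊔-assoc; ⊔-sel; x≤x⊔y; x≤y⊔x; maxOperator)
    renaming (x⊔y≈y⇒x≤y to ⊔⇒≤)
  open Min (CompleteOrderedField.totalOrder ℝ) public
    using (x≤y⇒x⊓y≈x; x≤y⇒y⊓x≈x; ⊓-comm; ⊓-assoc; ⊓-sel; ⊓-glb; x⊓y≤x; x⊓y≤y; minOperator)
  open MinMaxOp minOperator maxOperator using (⊓-absorbs-⊔; ⊔-absorbs-⊓)
  open RingProperties (CompleteOrderedField.ring ℝ) public
    using (-1*x≈-x; -‿distribˡ-*; -‿distribʳ-*; -‿involutive)

  private
    A = ℝ-algebra ℝ
    module A = σAlgebra A

  ∧≈⊓ : ∀ x y → x A.∧ y ≈ x ⊓ y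
  ∧≈⊓ x y = trans (-1*x≈-x _) (trans (-‿cong (⊔-cong (-1*x≈-x x) (-1*x≈-x y))) -⊔-)
    where
    -⊔- : - ((- x) ⊔ (- y)) ≈ x ⊓ y
    -⊔- with total x y
    ... | inj₁ x≤y = trans (-‿cong (x≤y⇒y⊔x≈y (neg-anti x≤y))) (-‿involutive x)
    ... | inj₂ y≤x = trans (-‿cong (x≤y⇒x⊔y≈y (neg-anti y≤x))) (-‿involutive y)

  A-isVectorSpace : IsLeftModule (CompleteOrderedField.ring ℝ) _≈_ _+_ 0# A.neg _*_
  A-isVectorSpace = record
    { isLeftSemimodule = record
      { +ᴹ-isCommutativeMonoid = CompleteOrderedField.+-isCommutativeMonoid ℝ
      ; isPreleftSemimodule = record
        { *ₗ-cong = *-cong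
        ; *ₗ-zeroˡ = CompleteOrderedField.zeroˡ ℝ
        ; *ₗ-distribʳ = CompleteOrderedField.distribʳ ℝ
        ; *ₗ-identityˡ = *-identityˡ
        ; *ₗ-assoc = *-assoc
        ; *ₗ-zeroʳ = zeroʳ
        ; *ₗ-distribˡ = distribˡ
        }
      }
    ; -ᴹ‿cong = *-cong refl
    ; -ᴹ‿inverse =
        (λ x → trans (+-cong (-1*x≈-x x) refl) (CompleteOrderedField.-‿inverseˡ ℝ x)) ,
        (λ x → trans (+-cong refl (-1*x≈-x x)) (-‿inverseʳ x))
    }

  A-isLattice : IsLattice _≈_ _⊔_ A._∧_
  A-isLattice = record
    { isEquivalence = CompleteOrderedField.isEquivalence ℝ
    ; ∨-comm = ⊔-comm
    ; ∨-assoc = ⊔-assoc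
    ; ∨-cong = ⊔-cong
    ; ∧-comm = λ x y → via (∧≈⊓ x y) (⊓-comm x y) (∧≈⊓ y x)
    ; ∧-assoc = λ x y z → via
        (trans (∧≈⊓ _ z) (⊓-cong (∧≈⊓ x y) refl)) (⊓-assoc x y z)
        (trans (∧≈⊓ x _) (⊓-cong refl (∧≈⊓ y z)))
    ; ∧-cong = λ x≈ y≈ → via (∧≈⊓ _ _) (⊓-cong x≈ y≈) (∧≈⊓ _ _)
    ; absorptive =
        (λ x y → trans (⊔-cong refl (∧≈⊓ x y)) (⊔-absorbs-⊓ x y)) ,
        (λ x y → trans (∧≈⊓ x _) (⊓-absorbs-⊔ x y))
    }
    where
    via : ∀ {a b c d} → a ≈ b → b ≈ c → d ≈ c → a ≈ d
    via p q r = trans p (trans q (sym r))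

  A-isRieszSpace : IsRieszSpace ℝ A
  A-isRieszSpace = record
    { isVectorSpace = A-isVectorSpace
    ; isLattice = A-isLattice
    ; +-mono = λ {x} {y} z x≤y → x≤y⇒x⊔y≈y (+-mono (⊔⇒≤ {x} {y} x≤y) ≤-refl)
    ; ·-nonNegative = λ {a} {x} 0≤a 0≤x →
        x≤y⇒x⊔y≈y (*-nonNegative 0≤a (⊔⇒≤ {0#} {x} 0≤x))
    }

  0≤1 : 0# ≤ 1#
  0≤1 with total 0# 1#
  ... | inj₁ 0≤1 = 0≤1
  ... | inj₂ 1≤0 = ≤-respʳ-≈
    (trans (-1*x≈-x (- 1#)) (-‿involutive 1#)) (*-nonNegative 0≤-1 0≤-1)
    where
    0≤-1 = linear 1≤0 (solve 1 (λ a → 𝟘 ⊕ ⊖ ⊖ a ⊜ a ⊕ ⊖ 𝟘) ≡.refl 1#)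

  bounded-multiples⇒≤0 : ∀ {x b} → (∀ n → (n ×ₙ x) ≤ b) → x ≤ 0#
  bounded-multiples⇒≤0 {x} {b} nx≤b = multiples-supremum⇒≤0 (proj₂
    (complete (Range _≈_ (_×ₙ x)) (0# , 0 , refl)
      (b , λ y (n , y≈) → ≤-respˡ-≈ (sym y≈) (nx≤b n))))

  private
    module R = RieszSpace ℝ A A-isRieszSpace

  A-isTruncation : IsTruncation ℝ A
  A-isTruncation = record
    { T1  = T1
    ; T2  = λ x 0≤x → x≤y⇒x⊔y≈y (⊓-glb (⊔⇒≤ 0≤x) 0≤1)
    ; T3ˡ = λ x y _ _ → x≤y⇒x⊔y≈y (≤-respˡ-≈ (sym (∧≈⊓ x _))
        (⊓-glb (x⊓y≤x x (y ⊓ 1#)) (≤-trans (x⊓y≤y x (y ⊓ 1#)) (x⊓y≤y y 1#))))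
    ; T3ʳ = λ x _ → x≤y⇒x⊔y≈y (x⊓y≤x x 1#)
    ; T4  = T4
    ; T5  = λ x 0≤x nx≈ → ≤-antisym
        (bounded-multiples⇒≤0 λ n → ≤-respˡ-≈ (sym (nx≈ n)) (x⊓y≤y (n ×ₙ x) 1#))
        (⊔⇒≤ 0≤x)
    }
    where
    T1 : ∀ x → x ⊓ 1# ≈ (x A.⁺ ⊓ 1#) A.- x A.⁻
    T1 x with total x 0#
    ... | inj₁ x≤0 = trans (x≤y⇒x⊓y≈x (≤-trans x≤0 0≤1)) (sym (trans
      (+-cong (x≤y⇒x⊓y≈x (≤-trans (≤-reflexive (x≤y⇒x⊔y≈y x≤0)) 0≤1)) refl) (R.⁺-⁻ x)))
    ... | inj₂ 0≤x = trans
      -- The inserted zero `x - x` is rewritten as `A.neg (x A.⁻)`, using `x = x⁺ - x⁻` and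
      -- `x⁺ = x`.
      (solve 2 (λ a b → a ⊜ a ⊕ (b ⊕ ⊖ b)) ≡.refl (x ⊓ 1#) x)
      (+-cong (⊓-cong (sym x⁺≈x) refl)
        (trans (+-cong (trans (sym (R.⁺-⁻ x)) (+-cong x⁺≈x refl)) refl)
          (solve 2 (λ a b → (a ⊕ b) ⊕ ⊖ a ⊜ b) ≡.refl x (A.neg (x A.⁻)))))
      where x⁺≈x = x≤y⇒y⊔x≈y 0≤x
    T4 : ∀ x → 0# A.≤ x → x ⊓ 1# ≈ 0# → x ≈ 0#
    T4 x 0≤x x⊓1≈0 =
      [ (λ x≤1 → trans (sym (x≤y⇒x⊓y≈x x≤1)) x⊓1≈0)
      , (λ 1≤x → contradiction (trans (sym x⊓1≈0) (x≤y⇒y⊓x≈x 1≤x)) 0#≉1#) ]′ (total x 1#)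

  A-⋎-supremum : ∀ g f → IsSupremum A._≤_ (Range _≈_ λ n → f n A.∧ g) (sup⊓ g f)
  A-⋎-supremum g f =
    (λ x (n , x≈) → x≤y⇒x⊔y≈y
      (proj₁ (sup⊓-isSupremum g f) x (n , trans x≈ (∧≈⊓ (f n) g)))) ,
    (λ u bound → x≤y⇒x⊔y≈y (proj₂ (sup⊓-isSupremum g f) u
      λ x (n , x≈) → ⊔⇒≤ (bound x (n , trans x≈ (sym (∧≈⊓ (f n) g))))))

  ℝ-truncatedRieszSpace : IsDedekindσCompleteTruncatedRieszSpace ℝ A
  ℝ-truncatedRieszSpace = record
    { isRieszSpace = A-isRieszSpace
    ; isTruncation = A-isTruncation
    ; isDedekindσComplete = R.⋎-supremum⇒complete A-⋎-supremum
    ; ⋎-isSupremum = A-⋎-supremum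
    }

  *-monoʳ : ∀ {a x y} → 0# ≤ a → x ≤ y → (a * x) ≤ (a * y)
  *-monoʳ {a} {x} {y} 0≤a x≤y = linear (*-nonNegative 0≤a (sub-nonNeg x≤y))
    (trans (solve 2 (λ f g → f ⊕ ⊖ g ⊜ 𝟘 ⊕ ⊖ (g ⊕ ⊖ f)) ≡.refl (a * x) (a * y))
      (+-cong refl (-‿cong (trans (+-cong refl (-‿distribʳ-* a x)) (sym (distribˡ a y (- x)))))))

-- Strict order and approximation in the reals

module ClassicalReals {ℓ : Level} (em : ExcludedMiddle ℓ) (ℝ : CompleteOrderedField ℓ) where

  open Reals ℝ public

  open SemiringMult (CompleteOrderedField.semiring ℝ) using (×-assoc-*)

  infix 4 _<_
  _<_ : Carrier → Carrier → Set ℓ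
  x < y = ¬ (y ≤ x)

  <⇒≤ : ∀ {x y} → x < y → x ≤ y
  <⇒≤ {x} {y} x<y = [ (λ x≤y → x≤y) , (λ y≤x → contradiction y≤x x<y) ]′ (total x y)

  ≤-<-trans : ∀ {x y z} → x ≤ y → y < z → x < z
  ≤-<-trans x≤y y<z z≤x = y<z (≤-trans z≤x x≤y)

  <-≤-trans : ∀ {x y z} → x < y → y ≤ z → x < z
  <-≤-trans x<y y≤z z≤x = x<y (≤-trans y≤z z≤x)

  neg-<-swap : ∀ {x y} → (- x) < y → (- y) < x
  neg-<-swap {x} {y} -x<y x≤-y = -x<y
    (linear x≤-y (solve 2 (λ x y → y ⊕ ⊖ ⊖ x ⊜ x ⊕ ⊖ ⊖ y) ≡.refl x y))

  sub-positive : ∀ {x y} → x < y → 0# < (y + (- x))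
  sub-positive {x} {y} x<y p = x<y
    (linear p (solve 2 (λ x y → y ⊕ ⊖ x ⊜ (y ⊕ ⊖ x) ⊕ ⊖ 𝟘) ≡.refl x y))

  0<1 : 0# < 1#
  0<1 1≤0 = 0#≉1# (≤-antisym 0≤1 1≤0)

  0<suc×1 : ∀ n → 0# < (suc n ×ₙ 1#)
  0<suc×1 n = <-≤-trans 0<1 (a≤a+b (×-nonNeg n 0≤1))

  positive-inverse : ∀ {x} → 0# < x → ∃ λ y → 0# < y × (x * y) ≈ 1#
  positive-inverse {x} 0<x = y , 0<y , xy≈1
    where
    x⁻¹ = inverse x (λ x≈0 → 0<x (≤-reflexive x≈0))
    y = proj₁ x⁻¹
    xy≈1 = proj₂ x⁻¹
    0<y : 0# < y
    0<y y≤0 = 0<1 (≤-respʳ-≈ (zeroʳ x) (≤-respˡ-≈ xy≈1 (*-monoʳ (<⇒≤ 0<x) y≤0)))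

  archimedean : ∀ {δ} → 0# < δ → ∀ b → ∃ λ n → b ≤ (n ×ₙ δ)
  archimedean {δ} 0<δ b with em {∃ λ n → b ≤ (n ×ₙ δ)}
  ... | yes found = found
  ... | no  none  = contradiction
    (bounded-multiples⇒≤0 λ n → <⇒≤ (λ b≤nδ → none (n , b≤nδ))) 0<δ

  abstract

    -- The number `1 / (n + 1)`; it serves as the scale of precisions.
    ε : ℕ → Carrier
    ε n = proj₁ (positive-inverse (0<suc×1 n))

    0<ε : ∀ n → 0# < ε n
    0<ε n = proj₁ (proj₂ (positive-inverse (0<suc×1 n)))

    ε-multiple : ∀ n → (suc n ×ₙ ε n) ≈ 1#
    ε-multiple n = trans (×-congʳ (suc n) (sym (*-identityˡ (ε n))))
      (trans (sym (×-assoc-* (suc n) 1# (ε n))) (proj₂ (proj₂ (positive-inverse (0<suc×1 n)))))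

  ε-small : ∀ {δ} → 0# < δ → ∃ λ n → ε n ≤ δ
  ε-small {δ} 0<δ with archimedean 0<δ 1#
  -- If `δ ≤ ε n` held, then `(n + 1) ε n = 1 ≤ n δ ≤ n ε n` would give `ε n ≤ 0`.
  ... | n , 1≤nδ = n , <⇒≤ λ δ≤ε → 0<ε n (linear
    (≤-trans (≤-reflexive (ε-multiple n)) (≤-trans 1≤nδ (×-mono n δ≤ε)))
    (solve 2 (λ e ne → e ⊕ ⊖ 𝟘 ⊜ (e ⊕ ne) ⊕ ⊖ ne) ≡.refl (ε n) (n ×ₙ ε n)))

  half : ∀ {d} → 0# < d → ∃ λ c → 0# < c × (c + c) ≈ d
  half {d} 0<d = c , 0<c , c+c≈d
    where
    0<2 : 0# < (1# + 1#)
    0<2 = <-≤-trans 0<1 (a≤a+b 0≤1)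
    y = proj₁ (positive-inverse 0<2)
    c = d * y
    c+c≈d : (c + c) ≈ d
    c+c≈d = trans (sym (distribˡ d y y)) (trans (*-cong refl (trans
      (sym (+-cong (*-identityˡ y) (*-identityˡ y)))
      (trans (sym (CompleteOrderedField.distribʳ ℝ y 1# 1#))
        (proj₂ (proj₂ (positive-inverse 0<2)))))) (*-identityʳ d))
    0<c : 0# < c
    0<c c≤0 = 0<d (≤-respˡ-≈ c+c≈d (≤-respʳ-≈ (+-identityˡ 0#) (+-mono c≤0 c≤0)))

  -- Half of the slack `a - (r + s)` goes to each summand.
  split : ∀ {r s a} → (r + s) < a → ∃ λ b → ∃ λ c → r < b × s < c × (b + c) ≈ a
  split {r} {s} {a} r+s<a with half (sub-positive r+s<a)
  ... | d , 0<d , d+d≈ = (r + d) , (s + d) ,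
    (λ p → 0<d (linear p (solve 2 (λ r d → d ⊕ ⊖ 𝟘 ⊜ (r ⊕ d) ⊕ ⊖ r) ≡.refl r d))) ,
    (λ p → 0<d (linear p (solve 2 (λ r d → d ⊕ ⊖ 𝟘 ⊜ (r ⊕ d) ⊕ ⊖ r) ≡.refl s d))) ,
    trans (solve 3 (λ r s d → (r ⊕ d) ⊕ (s ⊕ d) ⊜ (d ⊕ d) ⊕ (r ⊕ s)) ≡.refl r s d)
    (trans (+-cong d+d≈ refl)
      (solve 3 (λ r s a → (a ⊕ ⊖ (r ⊕ s)) ⊕ (r ⊕ s) ⊜ a) ≡.refl r s a))

  divide : ∀ {c r a} → 0# < c → (c * r) < a → ∃ λ b → r < b × (c * b) ≈ a
  divide {c} {r} {a} 0<c cr<a with positive-inverse 0<c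
  ... | y , _ , cy≈1 = (y * a) ,
    (λ ya≤r → cr<a (≤-respˡ-≈ cya≈a (*-monoʳ (<⇒≤ 0<c) ya≤r))) , cya≈a
    where
    cya≈a : (c * (y * a)) ≈ a
    cya≈a = trans (sym (*-assoc c y a)) (trans (*-cong cy≈1 refl) (*-identityˡ a))

  approximate : ∀ {P : Pred Carrier ℓ} {s a} → IsSupremum _≤_ P s → a < s →
                ∃ λ x → P x × a < x
  approximate {P} {s} {a} (_ , least) a<s with em {∃ λ x → P x × a < x}
  ... | yes found = found
  ... | no  none  = contradiction
    (least a upper) a<s
    where
    upper : ∀ x → P x → x ≤ a
    upper x Px with em {x ≤ a}
    ... | yes x≤a = x≤a
    ... | no  a<x = contradiction (x , Px , a<x) none

  -- A member closer than `δ` to the supremum of `P` will do.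
  last-step : ∀ (P : Pred Carrier ℓ) {δ} → ∃ P → ∃ (IsUpperBound _≤_ P) → 0# < δ →
              ∃ λ a → P a × ¬ P (a + δ)
  last-step P {δ} inhabited bounded 0<δ =
    let s , sup@(upper , _) = complete P inhabited bounded
        a , a∈P , s-δ<a = approximate sup λ s≤s-δ → 0<δ (a≤a-b⇒b≤0 s≤s-δ)
    in a , a∈P , λ a+δ∈P → s-δ<a (linear (upper (a + δ) a+δ∈P)
      (solve 3 (λ a δ s → a ⊕ ⊖ (s ⊕ ⊖ δ) ⊜ (a ⊕ δ) ⊕ ⊖ s) ≡.refl a δ s))

-- Enumeration of pairs

module Pairing where

  -- Cantor's walk along the antidiagonals.
  next : ℕ × ℕ → ℕ × ℕ
  next (i , zero)  = zero , suc i
  next (i , suc j) = suc i , j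

  unpair : ℕ → ℕ × ℕ
  unpair zero    = zero , zero
  unpair (suc n) = next (unpair n)

  -- The walk is traced backwards: lowering `i` stays on the diagonal, and its start `(0 , suc j)`
  -- is reached from the end `(j , 0)` of the preceding diagonal.
  unpair-onto-diagonal : ∀ d i j → i ℕ.+ j ≡ d → ∃ λ n → unpair n ≡ (i , j)
  unpair-onto-diagonal d       (suc i) j       eq
    with unpair-onto-diagonal d i (suc j) (≡.trans (ℕ.+-suc i j) eq)
  ... | n , eq′ = suc n , ≡.cong next eq′
  unpair-onto-diagonal zero    zero    zero    eq = zero , ≡.refl
  unpair-onto-diagonal (suc d) zero    (suc j) eq
    with unpair-onto-diagonal d j zero (≡.trans (ℕ.+-identityʳ j) (ℕ.suc-injective eq))
  ... | n , eq′ = suc n , ≡.cong next eq′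

  unpair-onto : ∀ ij → ∃ λ n → unpair n ≡ ij
  unpair-onto (i , j) = unpair-onto-diagonal (i ℕ.+ j) i j ≡.refl

-- Forcing conditions and dense requirements

module Forcing {ℓ : Level} (em : ExcludedMiddle ℓ) (ℝ : CompleteOrderedField ℓ)
  {G : σAlgebra ℝ} (K-G : IsDedekindσCompleteTruncatedRieszSpace ℝ G)
  (h : σAlgebra.Carrier G) (0≤h : σAlgebra._≤_ G (σAlgebra.0# G) h)
  (h≰trunc-h : ¬ (σAlgebra._≤_ G h (σAlgebra.trunc G h))) where

  open TruncatedRieszSpace ℝ G K-G
  open Terms ℝ using (Term; var; 𝟎; _⊞_; _⊻_; _⊡_; sup; cut; eval)
  open Pairing
  private module R = ClassicalReals em ℝ

  e p₀ : Carrier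
  e  = trunc h
  p₀ = excess h

  0≤e : 0# ≤ e
  0≤e = T2 h 0≤h

  ·e-mono : ∀ {a b} → a R.≤ b → a · e ≤ b · e
  ·e-mono {a} {b} a≤b = linear (·-nonNegative (R.sub-nonNeg a≤b) 0≤e)
    (trans (solve 2 (λ x y → x ⊕ ⊖ y ⊜ 𝟘 ⊕ ⊖ (y ⊕ ⊖ x)) ≡.refl (a · e) (b · e))
      (+-cong refl (neg-cong (trans (+-cong refl (sym (-·≈neg· a e)))
        (sym (·-distribʳ e b (R.- a)))))))

  ×· : ∀ n a f → (n R.×ₙ a) · f ≈ n ×ℕ (a · f)
  ×· zero    a f = ·-zeroˡ f
  ×· (suc n) a f = trans (·-distribʳ f a _) (+-cong refl (×· n a f))

  Disjoint : Carrier → Carrier → Set ℓ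
  Disjoint p x = 0# ≤ x × p ∧ x ≤ 0#

  -- On the band generated by p, f is at most g.
  infix 4 _≤[_]_
  _≤[_]_ : Carrier → Carrier → Carrier → Set ℓ
  f ≤[ p ] g = ∃ λ x → Disjoint p x × f ≤ g + x

  -- The forcing conditions; a smaller one decides more.
  Condition : Carrier → Set ℓ
  Condition p = 0# ≤ p × p ≤ p₀ × ¬ (p ≤ 0#)

  Below : Carrier → (Carrier → Set ℓ) → Set ℓ
  Below p Q = ∃ λ q → Condition q × q ≤ p × Q q

  -- `w` is its own meet with `a + x`, hence at most `(w ∧ a) + (w ∧ x)`.
  disjoint-below : ∀ {x w a} → 0# ≤ w → 0# ≤ a → 0# ≤ x → w ∧ x ≤ 0# → w ≤ a + x → w ≤ a
  disjoint-below {x} {w} {a} 0≤w 0≤a 0≤x w∧x≤0 w≤a+x =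
    ≤-trans (∧-greatest ≤-refl w≤a+x) (≤-trans (∧-subadditive 0≤w 0≤a 0≤x)
      (≤-respʳ-≈ (+-identityʳ a) (+-mono (∧-lowerʳ w a) w∧x≤0)))

  disjoint-antitone : ∀ {p q x} → q ≤ p → Disjoint p x → Disjoint q x
  disjoint-antitone q≤p (0≤x , p∧x≤0) = 0≤x , ≤-trans (∧-mono q≤p ≤-refl) p∧x≤0

  ≤[]-antitone : ∀ {p q f g} → q ≤ p → f ≤[ p ] g → f ≤[ q ] g
  ≤[]-antitone q≤p (x , d , f≤g+x) = x , disjoint-antitone q≤p d , f≤g+x

  ≤⇒≤[] : ∀ {p f g} → f ≤ g → f ≤[ p ] g
  ≤⇒≤[] {p} f≤g = 0# , (≤-refl , ∧-lowerʳ p 0#) , ≤-respʳ-≈ (sym (+-identityʳ _)) f≤g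

  module _ {p} (0≤p : 0# ≤ p) where

    disjoint-+ : ∀ {x y} → Disjoint p x → Disjoint p y → Disjoint p (x + y)
    disjoint-+ (0≤x , p∧x≤0) (0≤y , p∧y≤0) = +-nonNeg 0≤x 0≤y ,
      ≤-trans (∧-subadditive 0≤p 0≤x 0≤y) (≤-respʳ-≈ (+-identityˡ 0#) (+-mono p∧x≤0 p∧y≤0))

    disjoint-· : ∀ {a x} → R.0# R.≤ a → Disjoint p x → Disjoint p (a · x)
    disjoint-· {a} {x} 0≤a (0≤x , p∧x≤0) = ·-nonNegative 0≤a 0≤x ,
      ≤-trans (∧-mono ≤-refl ax≤nx) (disjoint-× n 0≤p 0≤x p∧x≤0)
      where
      n = proj₁ (R.archimedean R.0<1 a)
      ax≤nx : a · x ≤ n ×ℕ x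
      ax≤nx = linear (·-nonNegative (R.sub-nonNeg (proj₂ (R.archimedean R.0<1 a))) 0≤x)
        (trans (solve 2 (λ x y → x ⊕ ⊖ y ⊜ 𝟘 ⊕ ⊖ (y ⊕ ⊖ x)) ≡.refl (a · x) (n ×ℕ x))
          (+-cong refl (neg-cong (trans
            (+-cong (trans (×-congʳ n (sym (·-identityˡ x))) (sym (×· n R.1# x)))
              (sym (-·≈neg· a x)))
            (sym (·-distribʳ x _ (R.- a)))))))

    ≤[]-trans : ∀ {f g k} → f ≤[ p ] g → g ≤[ p ] k → f ≤[ p ] k
    ≤[]-trans {f} {g} {k} (x , dx , f≤g+x) (y , dy , g≤k+y) = x + y , disjoint-+ dx dy ,
      linear (+-mono f≤g+x g≤k+y)
        (solve 5 (λ f g k x y → f ⊕ ⊖ (k ⊕ (x ⊕ y)) ⊜ (f ⊕ g) ⊕ ⊖ ((g ⊕ x) ⊕ (k ⊕ y)))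
          ≡.refl f g k x y)

    ≤[]-+ : ∀ {f f′ g g′} → f ≤[ p ] g → f′ ≤[ p ] g′ → f + f′ ≤[ p ] g + g′
    ≤[]-+ {f} {f′} {g} {g′} (x , dx , f≤) (y , dy , f′≤) = x + y , disjoint-+ dx dy ,
      ≤-respʳ-≈ (solve 4 (λ g g′ x y → (g ⊕ x) ⊕ (g′ ⊕ y) ⊜ (g ⊕ g′) ⊕ (x ⊕ y))
        ≡.refl g g′ x y) (+-mono f≤ f′≤)

    ≤[]-∨ : ∀ {f f′ g} → f ≤[ p ] g → f′ ≤[ p ] g → f ∨ f′ ≤[ p ] g
    ≤[]-∨ {f} {f′} {g} (x , dx , f≤) (y , dy , f′≤) = x + y , disjoint-+ dx dy ,
      ∨-least (≤-trans f≤ (+-mono ≤-refl (a≤a+b (proj₁ dy))))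
              (≤-trans f′≤ (+-mono ≤-refl (a≤b+a (proj₁ dx))))

    ≤[]-· : ∀ {a f g} → R.0# R.≤ a → f ≤[ p ] g → a · f ≤[ p ] a · g
    ≤[]-· {a} 0≤a (x , dx , f≤) = a · x , disjoint-· 0≤a dx ,
      ≤-respʳ-≈ (·-distribˡ a _ x) (·-monoʳ 0≤a f≤)

  -- If `p` is disjoint from `(f - g) ⁺`, the first case holds. Otherwise their meet is a condition,
  -- and it is disjoint from `(g - f) ⁺`.
  dichotomy : ∀ {p} → Condition p → ∀ f g → f ≤[ p ] g ⊎ Below p (λ q → g ≤[ q ] f)
  dichotomy {p} (0≤p , p≤p₀ , p≰0) f g with em {p ∧ (f - g) ⁺ ≤ 0#}
  ... | yes disjoint = inj₁ ((f - g) ⁺ , (0≤⁺ _ , disjoint) , ≤+⁺ f g)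
  ... | no  q≰0      = inj₂ (q , (∧-greatest 0≤p (0≤⁺ _) , ≤-trans q≤p p≤p₀ , q≰0) , q≤p ,
    (g - f) ⁺ , (0≤⁺ _ , ≤-trans (∧-mono (∧-lowerʳ _ _) ≤-refl) (differences-disjoint f g)) ,
    ≤+⁺ g f)
    where
    q = p ∧ (f - g) ⁺
    q≤p : q ≤ p
    q≤p = ∧-lowerˡ _ _

  p₀-condition : Condition p₀
  p₀-condition = excess-nonNeg 0≤h , ≤-refl , λ p₀≤0 → h≰trunc-h
    (linear p₀≤0 (solve 2 (λ h e → h ⊕ ⊖ e ⊜ (h ⊕ ⊖ e) ⊕ ⊖ 𝟘) ≡.refl h e))

  -- This makes `e` a weak unit below `p₀`: as `p ≤ p₀ ≤ h`, `trunc p` is below `e` as well as below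
  -- `p`, so disjointness and `T4` would give `p ≈ 0#`.
  condition-meets-e : ∀ {p} → Condition p → ¬ (p ∧ e ≤ 0#)
  condition-meets-e {p} (0≤p , p≤p₀ , p≰0) p∧e≤0 =
    p≰0 (≤-reflexive (T4 p 0≤p (≤-antisym trunc-p≤0 (T2 p 0≤p))))
    where
    trunc-p≤0 : trunc p ≤ 0#
    trunc-p≤0 = ≤-trans
      (∧-greatest (T3ʳ p 0≤p) (trunc-mono 0≤p (≤-trans p≤p₀ (excess-≤ 0≤h)))) p∧e≤0

  -- If `b < a`, then `(a - b) · e ≤ x`, so `e` is below a multiple of `x` and therefore disjoint
  -- from `p`, against `condition-meets-e`.
  consistent : ∀ {p a b} → Condition p → a · e ≤[ p ] b · e → a R.≤ b
  consistent {p} {a} {b} cond@(0≤p , _ , _) (x , (0≤x , p∧x≤0) , ae≤be+x) with em {a R.≤ b}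
  ... | yes a≤b = a≤b
  ... | no  b<a = contradiction
    (≤-trans (∧-mono ≤-refl e≤nx) (disjoint-× n 0≤p 0≤x p∧x≤0)) (condition-meets-e cond)
    where
    η = a R.+ (R.- b)
    n = proj₁ (R.archimedean (R.sub-positive b<a) R.1#)
    ηe≤x : η · e ≤ x
    ηe≤x = ≤-respˡ-≈ (sym (trans (·-distribʳ e a (R.- b)) (+-cong refl (-·≈neg· b e))))
      (linear ae≤be+x (solve 3 (λ a b x → (a ⊕ ⊖ b) ⊕ ⊖ x ⊜ a ⊕ ⊖ (b ⊕ x)) ≡.refl
        (a · e) (b · e) x))
    e≤nx : e ≤ n ×ℕ x
    e≤nx = ≤-respˡ-≈ (·-identityˡ e)
      (≤-trans (·e-mono (proj₂ (R.archimedean (R.sub-positive b<a) R.1#)))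
        (≤-trans (≤-reflexive (×· n η e)) (×-mono n ηe≤x)))

  -- Otherwise `dichotomy` places every multiple of `e` below `f` on the band of `p`. All multiples
  -- of `p ∧ e` are then below `f ⁺`, so `p ∧ e ≤ 0#` by the Archimedean property.
  dense-bounded : ∀ {p} → Condition p → ∀ f → Below p λ q → ∃ λ c → f ≤[ q ] c · e
  dense-bounded {p} cond@(0≤p , _ , _) f
    with em {Below p λ q → ∃ λ c → f ≤[ q ] c · e}
  ... | yes found = found
  ... | no  none  = contradiction (archimedean nz≤f⁺) (condition-meets-e cond)
    where
    z = p ∧ e
    0≤z = ∧-greatest 0≤p 0≤e
    nz≤f⁺ : ∀ n → n ×ℕ z ≤ f ⁺
    nz≤f⁺ n with dichotomy cond ((n R.×ₙ R.1#) · e) f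
    ... | inj₂ (q , cond-q , q≤p , f≤ne) = contradiction (q , cond-q , q≤p , _ , f≤ne) none
    ... | inj₁ (x , (0≤x , p∧x≤0) , ne≤f+x) = disjoint-below
      (×-nonNeg n 0≤z) (0≤⁺ f) 0≤x
      (≤-respˡ-≈ (∧-comm x _) (disjoint-× n 0≤x 0≤z
        (≤-respˡ-≈ (∧-comm z x) (≤-trans (∧-mono (∧-lowerˡ p e) ≤-refl) p∧x≤0))))
      (≤-trans (×-mono n (∧-lowerʳ p e))
        (≤-trans (≤-reflexive (sym (trans (×· n R.1# e) (×-congʳ n (·-identityˡ e)))))
          (≤-trans ne≤f+x (+-mono (≤⁺ f) ≤-refl))))

  -- After `f` has been bounded on both sides, the multiples of `e` below `f` have bounded
  -- coefficients. From a last coefficient `a`, where adding `ε m` fails, `dichotomy` gives a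
  -- smaller condition with `f` below `(a + ε m) · e`.
  localise : ∀ {p} → Condition p → ∀ m f →
    Below p λ q → ∃ λ c → (c · e ≤[ q ] f) × (f ≤[ q ] (c R.+ R.ε m) · e)
  localise {p} cond m f
    with dense-bounded cond f
  ... | q , cond-q , q≤p , c , f≤ce
    with dense-bounded cond-q (neg f)
  ... | r , cond-r , r≤q , c′ , -f≤c′e =
    step (R.last-step P (R.- c′ , -c′∈P) (c , bound) (R.0<ε m))
    where
    0≤r = proj₁ cond-r
    P : Pred R.Carrier ℓ
    P a = a · e ≤[ r ] f
    -c′∈P : P (R.- c′)
    -c′∈P = let x , d , -f≤ = -f≤c′e in x , d , linear -f≤ (trans
      (+-cong (-·≈neg· c′ e) refl)
      (solve 3 (λ f c x → ⊖ c ⊕ ⊖ (f ⊕ x) ⊜ ⊖ f ⊕ ⊖ (c ⊕ x)) ≡.refl f (c′ · e) x))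
    bound : ∀ a → P a → a R.≤ c
    bound a a∈P = consistent cond-r (≤[]-trans 0≤r a∈P (≤[]-antitone r≤q f≤ce))
    step : (∃ λ a → P a × ¬ P (a R.+ R.ε m)) →
           Below p λ q → ∃ λ c → (c · e ≤[ q ] f) × (f ≤[ q ] (c R.+ R.ε m) · e)
    step (a , a∈P , a+ε∉P) =
      [ (λ a+ε∈P → contradiction a+ε∈P a+ε∉P)
      , (λ (t , cond-t , t≤r , f≤) →
          t , cond-t , ≤-trans t≤r (≤-trans r≤q q≤p) , a , ≤[]-antitone t≤r a∈P , f≤)
      ]′ (dichotomy cond-r ((a R.+ R.ε m) · e) f)

  -- Otherwise `dichotomy` keeps every `f n ∧ g` at distance `ε m · e` from `s = ⋎ g f` on the band
  -- of `p`, so all of them are below `s - q`. Then `q ≤ 0#`, that is, `ε m · e` is disjoint from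
  -- `p`, and `consistent` yields `ε m ≤ 0`.
  attain : ∀ {p} → Condition p → ∀ m g f →
    Below p λ q → ∃ λ n → ⋎ g f ≤[ q ] (f n ∧ g) + R.ε m · e
  attain {p} cond@(0≤p , _ , _) m g f
    with em {Below p λ q → ∃ λ n → ⋎ g f ≤[ q ] (f n ∧ g) + R.ε m · e}
  ... | yes found = found
  ... | no  none  = contradiction (consistent cond εe≤0) (R.0<ε m)
    where
    s = ⋎ g f
    εe = R.ε m · e
    q = p ∧ εe
    0≤εe = ·-nonNegative (R.<⇒≤ (R.0<ε m)) 0≤e
    0≤q = ∧-greatest 0≤p 0≤εe
    fn∧g≤s-q : ∀ n → f n ∧ g ≤ s - q
    fn∧g≤s-q n with dichotomy cond ((f n ∧ g) + εe) s
    ... | inj₂ (r , cond-r , r≤p , s≤) = contradiction (r , cond-r , r≤p , n , s≤) none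
    ... | inj₁ (x , (0≤x , p∧x≤0) , ≤s+x) = linear
      (disjoint-below 0≤q (sub-nonNeg (⋎-upper g f n)) 0≤x
        (≤-trans (∧-mono (∧-lowerˡ p εe) ≤-refl) p∧x≤0)
        (≤-trans (∧-lowerʳ p εe) (linear ≤s+x
          (solve 4 (λ y ε s x → ε ⊕ ⊖ ((s ⊕ ⊖ y) ⊕ x) ⊜ (y ⊕ ε) ⊕ ⊖ (s ⊕ x)) ≡.refl
            (f n ∧ g) εe s x))))
      (solve 3 (λ y s q → y ⊕ ⊖ (s ⊕ ⊖ q) ⊜ q ⊕ ⊖ (s ⊕ ⊖ y)) ≡.refl (f n ∧ g) s q)
    εe≤0 : R.ε m · e ≤[ p ] R.0# · e
    εe≤0 = εe , (0≤εe , supremum-gap (⋎-isSupremum g f) fn∧g≤s-q) ,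
      ≤-respʳ-≈ (trans (sym (+-identityˡ εe)) (+-cong (sym (·-zeroˡ e)) refl)) ≤-refl

  -- Let `z` be the part of `trunc (f ⁺) - e` met by `p`. As `p ≤ h - e`, the sum `e + z` is below
  -- `h`; it is also below `trunc (f ⁺ ∨ h)`. By `T3ˡ` it is below `trunc h`, which is `e`, so
  -- `z ≤ 0#`.
  trunc-≤e : ∀ {p} → Condition p → ∀ f → trunc f ≤[ p ] e
  trunc-≤e {p} (_ , p≤p₀ , _) f = x , (0≤⁺ _ , z≤0) , ≤-trans
    (≤-respˡ-≈ (sym (T1 f)) (linear (⁻-nonNeg f)
      (solve 2 (λ a b → (a ⊕ ⊖ b) ⊕ ⊖ a ⊜ 𝟘 ⊕ ⊖ b) ≡.refl (trunc (f ⁺)) (f ⁻))))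
    (≤+⁺ (trunc (f ⁺)) e)
    where
    x = (trunc (f ⁺) - e) ⁺
    z = p ∧ x
    0≤k : 0# ≤ f ⁺ ∨ h
    0≤k = ≤-trans 0≤h (∨-upperʳ _ h)
    e+z≤h : e + z ≤ h
    e+z≤h = linear (≤-trans (∧-lowerˡ p x) p≤p₀)
      (solve 3 (λ e z h → (e ⊕ z) ⊕ ⊖ h ⊜ z ⊕ ⊖ (h ⊕ ⊖ e)) ≡.refl e z h)
    x≤ : x ≤ trunc (f ⁺ ∨ h) - e
    x≤ = ∨-least (+-mono (trunc-mono (0≤⁺ f) (∨-upperˡ _ h)) ≤-refl)
      (sub-nonNeg (trunc-mono 0≤h (∨-upperʳ _ h)))
    e+z≤trunc : e + z ≤ trunc (f ⁺ ∨ h)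
    e+z≤trunc = linear (≤-trans (∧-lowerʳ p x) x≤)
      (solve 3 (λ e z t → (e ⊕ z) ⊕ ⊖ t ⊜ z ⊕ ⊖ (t ⊕ ⊖ e)) ≡.refl e z (trunc (f ⁺ ∨ h)))
    z≤0 : z ≤ 0#
    z≤0 = linear (≤-trans (∧-greatest e+z≤h e+z≤trunc) (T3ˡ h _ 0≤h 0≤k))
      (solve 2 (λ e z → z ⊕ ⊖ 𝟘 ⊜ (e ⊕ z) ⊕ ⊖ e) ≡.refl e z)

  trunc-≤ : ∀ f → trunc f ≤ f
  trunc-≤ f = ≤-respˡ-≈ (sym (T1 f)) (≤-respʳ-≈ (⁺-⁻ f) (+-mono (T3ʳ _ (0≤⁺ f)) ≤-refl))

  -- Adding `f ⁻` gives an element below `f ⁺ ∧ (e + f ⁻)`, hence below `(f ⁺ ∧ e) + (f ⁺ ∧ f ⁻)`;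
  -- the first summand is at most `trunc (f ⁺)` by `T3ˡ` and the second at most `0#`.
  ∧e-≤-trunc : ∀ f → f ∧ e ≤ trunc f
  ∧e-≤-trunc f = ≤-respʳ-≈ (sym (T1 f)) (linear
    (≤-trans (∧-greatest ≤f⁺ ≤e+f⁻) (≤-trans (∧-subadditive (0≤⁺ f) 0≤e (⁻-nonNeg f))
      (≤-respʳ-≈ (+-identityʳ _) (+-mono (T3ˡ (f ⁺) h (0≤⁺ f) 0≤h) (⁺∧⁻ f)))))
    (solve 3 (λ a b t → a ⊕ ⊖ (t ⊕ ⊖ b) ⊜ (a ⊕ b) ⊕ ⊖ t) ≡.refl (f ∧ e) (f ⁻) (trunc (f ⁺))))
    where
    ≤f⁺ : f ∧ e + f ⁻ ≤ f ⁺
    ≤f⁺ = linear (≤-trans (∧-lowerˡ f e) (≤-reflexive (sym (⁺-⁻ f))))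
      (solve 3 (λ a b c → (a ⊕ b) ⊕ ⊖ c ⊜ a ⊕ ⊖ (c ⊕ ⊖ b)) ≡.refl (f ∧ e) (f ⁻) (f ⁺))
    ≤e+f⁻ : f ∧ e + f ⁻ ≤ e + f ⁻
    ≤e+f⁻ = +-mono (∧-lowerʳ f e) ≤-refl

  -- In a requirement (i , j) on a compound term, i selects the immediate subterm
  -- concerned and j codes, through unpair, a requirement on that subterm; the
  -- requirement (0 , m) on sup is its own, with precision ε m.
  Meets : Term Carrier → ℕ × ℕ → Carrier → Set ℓ
  Meets (var g)   (_ , m)           p = ∃ λ c → (c · e ≤[ p ] g) × (g ≤[ p ] (c R.+ R.ε m) · e)
  Meets 𝟎         _                 p = Lift ℓ ⊤
  Meets (s ⊞ t)   (zero , j)        p = Meets s (unpair j) p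
  Meets (s ⊞ t)   (suc _ , j)       p = Meets t (unpair j) p
  Meets (s ⊻ t)   (zero , j)        p = Meets s (unpair j) p
  Meets (s ⊻ t)   (suc _ , j)       p = Meets t (unpair j) p
  Meets (a ⊡ t)   ij                p = Meets t ij p
  Meets (cut t)   ij                p = Meets t ij p
  Meets (sup t s) (zero , m)        p =
    let g = eval G (λ x → x) t; f = λ n → eval G (λ x → x) (s n) in
    ∃ λ n → ⋎ g f ≤[ p ] (f n ∧ g) + R.ε m · e
  Meets (sup t s) (suc zero , j)    p = Meets t (unpair j) p
  Meets (sup t s) (suc (suc n) , j) p = Meets (s n) (unpair j) p

  dense : ∀ t ij {p} → Condition p → Below p (Meets t ij)
  dense (var g)   (_ , m)           cond = localise cond m g
  dense 𝟎         _                 cond = _ , cond , ≤-refl , lift tt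
  dense (s ⊞ t)   (zero , j)        cond = dense s (unpair j) cond
  dense (s ⊞ t)   (suc _ , j)       cond = dense t (unpair j) cond
  dense (s ⊻ t)   (zero , j)        cond = dense s (unpair j) cond
  dense (s ⊻ t)   (suc _ , j)       cond = dense t (unpair j) cond
  dense (a ⊡ t)   ij                cond = dense t ij cond
  dense (cut t)   ij                cond = dense t ij cond
  dense (sup t s) (zero , m)        cond = attain cond m _ _
  dense (sup t s) (suc zero , j)    cond = dense t (unpair j) cond
  dense (sup t s) (suc (suc n) , j) cond = dense (s n) (unpair j) cond

  -- The generic sequence and limits along it

  module Generic (u : Term Carrier) where

    private
      -- The requirements on `u` are countably many, enumerated by `unpair`; stage `suc k` meets the
      -- one with number `k`.
      stage : ℕ → Σ Carrier Condition
      stage zero    = p₀ , p₀-condition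
      stage (suc k) = let q , cond-q , _ = dense u (unpair k) (proj₂ (stage k)) in q , cond-q

    opaque

      p : ℕ → Carrier
      p k = proj₁ (stage k)

      condition : ∀ k → Condition (p k)
      condition k = proj₂ (stage k)

      p-step : ∀ k → p (suc k) ≤ p k
      p-step k = proj₁ (proj₂ (proj₂ (dense u (unpair k) (proj₂ (stage k)))))

      p-meets : ∀ k → Meets u (unpair k) (p (suc k))
      p-meets k = proj₂ (proj₂ (proj₂ (dense u (unpair k) (proj₂ (stage k)))))

    p-antitone : ∀ j k → p (j ℕ.+ k) ≤ p k
    p-antitone zero    k = ≤-refl
    p-antitone (suc j) k = ≤-trans (p-step (j ℕ.+ k)) (p-antitone j k)

    0≤p : ∀ k → 0# ≤ p k
    0≤p k = proj₁ (condition k)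

    infix 4 _⊩_≤_
    _⊩_≤_ : ℕ → Carrier → Carrier → Set ℓ
    k ⊩ f ≤ g = f ≤[ p k ] g

    laterˡ : ∀ {j k f g} → j ⊩ f ≤ g → (j ℕ.+ k) ⊩ f ≤ g
    laterˡ {j} {k} =
      ≤[]-antitone (≡.subst (λ i → p i ≤ p j) (ℕ.+-comm k j) (p-antitone k j))

    laterʳ : ∀ {j k f g} → k ⊩ f ≤ g → (j ℕ.+ k) ⊩ f ≤ g
    laterʳ {j} {k} = ≤[]-antitone (p-antitone j k)

    -- The limit superior of `f` along the sequence, in units of `e`, is at most `r`.
    Upper : Carrier → R.Carrier → Set ℓ
    Upper f r = ∀ a → r R.< a → ∃ λ k → k ⊩ f ≤ a · e

    Limit : Carrier → R.Carrier → Set ℓ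
    Limit f r = Upper f r × Upper (neg f) (R.- r)

    Upper-mono : ∀ {f g r s} → f ≤ g → r R.≤ s → Upper g r → Upper f s
    Upper-mono f≤g r≤s U a s<a with U a (R.≤-<-trans r≤s s<a)
    ... | k , g≤ae = k , ≤[]-trans (0≤p k) (≤⇒≤[] f≤g) g≤ae

    Upper-cong : ∀ {f g r s} → f ≈ g → r R.≈ s → Upper g s → Upper f r
    Upper-cong f≈g r≈s = Upper-mono (≤-reflexive f≈g) (R.≤-reflexive (R.sym r≈s))

    Upper-zero : Upper 0# R.0#
    Upper-zero a 0<a = 0 , ≤⇒≤[] (·-nonNegative (R.<⇒≤ 0<a) 0≤e)

    Upper-e : Upper e R.1#
    Upper-e a 1<a = 0 , ≤⇒≤[] (≤-respˡ-≈ (·-identityˡ e) (·e-mono (R.<⇒≤ 1<a)))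

    Upper-+ : ∀ {f g r s} → Upper f r → Upper g s → Upper (f + g) (r R.+ s)
    Upper-+ Uf Ug a r+s<a =
      let b , c , r<b , s<c , b+c≈a = R.split r+s<a
          j , f≤ = Uf b r<b
          k , g≤ = Ug c s<c
      in j ℕ.+ k , ≤[]-trans (0≤p (j ℕ.+ k))
        (≤[]-+ (0≤p (j ℕ.+ k)) (laterˡ {j} {k} f≤) (laterʳ {j} {k} g≤))
        (≤⇒≤[] (≤-reflexive (trans (sym (·-distribʳ e b c)) (·-cong b+c≈a refl))))

    Upper-∨ : ∀ {f g r} → Upper f r → Upper g r → Upper (f ∨ g) r
    Upper-∨ Uf Ug a r<a =
      let j , f≤ = Uf a r<a
          k , g≤ = Ug a r<a
      in j ℕ.+ k , ≤[]-∨ (0≤p (j ℕ.+ k)) (laterˡ {j} {k} f≤) (laterʳ {j} {k} g≤)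

    Upper-· : ∀ {f r c} → R.0# R.≤ c → Upper f r → Upper (c · f) (c R.* r)
    Upper-· {f} {r} {c} 0≤c U with em {c R.≤ R.0#}
    -- The scalar zero is treated apart, since the other case divides by `c`.
    ... | yes c≤0 = Upper-cong
      (trans (·-cong (R.≤-antisym c≤0 0≤c) refl) (·-zeroˡ f))
      (R.trans (R.*-cong (R.≤-antisym c≤0 0≤c) R.refl) (R.zeroˡ r)) Upper-zero
    ... | no 0<c = λ a cr<a →
      let b , r<b , cb≈a = R.divide 0<c cr<a
          k , f≤be = U b r<b
      in k , ≤[]-trans (0≤p k) (≤[]-· (0≤p k) 0≤c f≤be)
        (≤⇒≤[] (≤-reflexive (trans (sym (·-assoc c b e)) (·-cong cb≈a refl))))

    Upper-⊓ : ∀ {f g m r s} → m ≤ f → m ≤ g → Upper f r → Upper g s → Upper m (r R.⊓ s)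
    Upper-⊓ {r = r} {s} m≤f m≤g Uf Ug =
      [ (λ ≈r → Upper-mono m≤f (R.≤-reflexive (R.sym ≈r)) Uf)
      , (λ ≈s → Upper-mono m≤g (R.≤-reflexive (R.sym ≈s)) Ug) ]′ (R.⊓-sel r s)

    Limit-cong : ∀ {f g r s} → f ≈ g → r R.≈ s → Limit g s → Limit f r
    Limit-cong f≈g r≈s (U , L) =
      Upper-cong f≈g r≈s U , Upper-cong (neg-cong f≈g) (R.-‿cong r≈s) L

    Limit-zero : Limit 0# R.0#
    Limit-zero = Upper-zero , Upper-cong (solve 0 (⊖ 𝟘 ⊜ 𝟘) ≡.refl)
      (R.solve 0 (R.⊖ R.𝟘 R.⊜ R.𝟘) ≡.refl) Upper-zero

    Limit-neg : ∀ {f r} → Limit f r → Limit (neg f) (R.- r)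
    Limit-neg {f} {r} (U , L) = L , Upper-cong (solve 1 (λ f → ⊖ ⊖ f ⊜ f) ≡.refl f)
      (R.-‿involutive r) U

    Limit-+ : ∀ {f g r s} → Limit f r → Limit g s → Limit (f + g) (r R.+ s)
    Limit-+ {f} {g} {r} {s} (Uf , Lf) (Ug , Lg) = Upper-+ Uf Ug , Upper-cong
      (solve 2 (λ f g → ⊖ (f ⊕ g) ⊜ ⊖ f ⊕ ⊖ g) ≡.refl f g)
      (R.solve 2 (λ f g → R.⊖ (f R.⊕ g) R.⊜ R.⊖ f R.⊕ R.⊖ g) ≡.refl r s) (Upper-+ Lf Lg)

    Limit-∨ : ∀ {f g r s} → Limit f r → Limit g s → Limit (f ∨ g) (r R.⊔ s)
    Limit-∨ {f} {g} {r} {s} (Uf , Lf) (Ug , Lg) =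
      Upper-∨ (Upper-mono ≤-refl (R.x≤x⊔y r s) Uf) (Upper-mono ≤-refl (R.x≤y⊔x r s) Ug) ,
      [ (λ ≈r → Upper-mono (neg-anti (∨-upperˡ f g)) (R.neg-anti (R.≤-reflexive ≈r)) Lf)
      , (λ ≈s → Upper-mono (neg-anti (∨-upperʳ f g)) (R.neg-anti (R.≤-reflexive ≈s)) Lg)
      ]′ (R.⊔-sel r s)

    Limit-·-nonNeg : ∀ {a f r} → R.0# R.≤ a → Limit f r → Limit (a · f) (a R.* r)
    Limit-·-nonNeg {a} {f} {r} 0≤a (U , L) = Upper-· 0≤a U ,
      Upper-cong (sym (·neg≈neg· a f)) (R.-‿distribʳ-* a r) (Upper-· 0≤a L)

    Limit-· : ∀ a {f r} → Limit f r → Limit (a · f) (a R.* r)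
    Limit-· a {f} {r} lim =
      [ (λ 0≤a → Limit-·-nonNeg 0≤a lim)
      , (λ a≤0 → Limit-cong
          (sym (trans (·neg≈neg· (R.- a) f) (trans (neg-cong (-·≈neg· a f))
            (solve 1 (λ f → ⊖ ⊖ f ⊜ f) ≡.refl (a · f)))))
          (R.sym (R.trans (R.sym (R.-‿distribˡ-* a (R.- r)))
            (R.trans (R.-‿cong (R.sym (R.-‿distribʳ-* a r))) (R.-‿involutive (a R.* r)))))
          (Limit-·-nonNeg (R.≤-respˡ-≈ (R.solve 0 (R.⊖ R.𝟘 R.⊜ R.𝟘) ≡.refl)
            (R.neg-anti a≤0)) (Limit-neg lim)))
      ]′ (R.total R.0# a)

    -- On the band `trunc f` behaves as `f ∧ e`: it is bounded above by `f` or by `e`, whichever has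
    -- the smaller limit, and below by `∧e-≤-trunc`.
    Limit-trunc : ∀ {f r} → Limit f r → Limit (trunc f) (r R.⊓ R.1#)
    Limit-trunc {f} {r} (U , L) =
      [ (λ ≈r → Upper-mono (trunc-≤ f) (R.≤-reflexive (R.sym ≈r)) U)
      , (λ ≈1 a r⊓1<a → 0 , ≤[]-trans (0≤p 0) (trunc-≤e (condition 0) f)
          (proj₂ (Upper-e a (R.≤-<-trans (R.≤-reflexive (R.sym ≈1)) r⊓1<a))))
      ]′ (R.⊓-sel r R.1#) ,
      Upper-mono neg-trunc≤ R.≤-refl (Upper-∨
        (Upper-mono ≤-refl (R.neg-anti (R.x⊓y≤x r R.1#)) L)
        (Upper-mono ≤-refl (R.neg-anti (R.x⊓y≤y r R.1#)) Lower-e))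
      where
      neg-trunc≤ : neg (trunc f) ≤ neg f ∨ neg e
      neg-trunc≤ = ≤-respʳ-≈ (solve 1 (λ f → ⊖ ⊖ f ⊜ f) ≡.refl (neg f ∨ neg e))
        (neg-anti (∧e-≤-trunc f))
      Lower-e : Upper (neg e) (R.- R.1#)
      Lower-e a -1<a = 0 , ≤⇒≤[] (≤-respˡ-≈ (trans (-·≈neg· R.1# e) (neg-cong (·-identityˡ e)))
        (·e-mono (R.<⇒≤ -1<a)))

    -- From above, `attained` replaces the supremum by a single `f n ∧ g` up to `ε m`, whose limit
    -- is at most `σ`. From below, the supremum dominates `f n ∧ g` for an `n` such that `r n ⊓ s`
    -- is close to `σ`.
    Limit-⋎ : ∀ {f g r s} → (∀ n → Limit (f n) (r n)) → Limit g s →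
      (∀ m → ∃ λ k → ∃ λ n → k ⊩ ⋎ g f ≤ (f n ∧ g) + R.ε m · e) →
      Limit (⋎ g f) (R.sup⊓ s r)
    Limit-⋎ {f} {g} {r} {s} lim-f lim-g attained = upper , lower
      where
      σ = R.sup⊓ s r
      rn⊓s≤σ : ∀ n → (r n R.⊓ s) R.≤ σ
      rn⊓s≤σ n = proj₁ (R.sup⊓-isSupremum s r) _ (n , R.refl)
      upper-close : ∀ {a b c} → σ R.< b → (b R.+ c) R.≈ a →
        (∃ λ m → R.ε m R.≤ c) → ∃ λ k → k ⊩ ⋎ g f ≤ a · e
      upper-close {a} {b} {c} σ<b b+c≈a (m , ε≤c) =
        let k , n , s≤ = attained m
            j , fn∧g≤ = Upper-⊓ (∧-lowerˡ (f n) g) (∧-lowerʳ (f n) g)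
              (proj₁ (lim-f n)) (proj₁ lim-g) b (R.≤-<-trans (rn⊓s≤σ n) σ<b)
        in k ℕ.+ j , ≤[]-trans (0≤p (k ℕ.+ j)) (laterˡ {k} {j} s≤)
          (≤[]-trans (0≤p (k ℕ.+ j))
            (≤[]-+ (0≤p (k ℕ.+ j)) (laterʳ {k} {j} fn∧g≤) (≤⇒≤[] (·e-mono ε≤c)))
            (≤⇒≤[] (≤-reflexive (trans (sym (·-distribʳ e b c)) (·-cong b+c≈a refl)))))
      upper : Upper (⋎ g f) σ
      upper a σ<a =
        -- The room between `σ` and `a` is shared: `b` bounds the chosen member and `c` absorbs the
        -- error `ε m`.
        let b , c , σ<b , 0<c , b+c≈a =
              R.split (R.≤-<-trans (R.≤-reflexive (R.+-identityʳ σ)) σ<a)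
        in upper-close σ<b b+c≈a (R.ε-small 0<c)
      neg-⋎≤ : ∀ n → neg (⋎ g f) ≤ neg (f n) ∨ neg g
      neg-⋎≤ n = ≤-respʳ-≈ (solve 1 (λ x → ⊖ ⊖ x ⊜ x) ≡.refl (neg (f n) ∨ neg g))
        (neg-anti (⋎-upper g f n))
      lower-close : ∀ {a} → (∃ λ x → Range R._≈_ (λ n → r n R.⊓ s) x × (R.- a) R.< x) →
        ∃ λ k → k ⊩ neg (⋎ g f) ≤ a · e
      lower-close {a} (x , (n , x≈) , -a<x) = Upper-mono (neg-⋎≤ n) R.≤-refl
        (Upper-∨ (Upper-mono ≤-refl (R.neg-anti (R.x⊓y≤x (r n) s)) (proj₂ (lim-f n)))
                 (Upper-mono ≤-refl (R.neg-anti (R.x⊓y≤y (r n) s)) (proj₂ lim-g)))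
        a (R.neg-<-swap (R.<-≤-trans -a<x (R.≤-reflexive x≈)))
      lower : Upper (neg (⋎ g f)) (R.- σ)
      lower a -σ<a = lower-close (R.approximate (R.sup⊓-isSupremum s r) (R.neg-<-swap -σ<a))

    Fulfilled : Term Carrier → Set ℓ
    Fulfilled t = ∀ ij → ∃ λ k → Meets t ij (p k)

    -- Requirements on a subterm come coded by one number; surjectivity of `unpair` ensures that
    -- none is missed.
    fulfilled : ∀ t → (∀ n → ∃ λ k → Meets t (unpair n) (p k)) → Fulfilled t
    fulfilled t F ij =
      let n , unpair-n≡ij = unpair-onto ij
          k , meets = F n
      in k , ≡.subst (λ ij → Meets t ij (p k)) unpair-n≡ij meets

    -- The limit is the supremum of the coefficients `a` for which `a · e ≤ g` is eventually forced.
    -- The requirement of precision `ε 0` makes these coefficients nonempty and bounded; that of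
    -- precision `ε m` bounds `g` by `s + ε m`.
    Limit-exists : ∀ g → Fulfilled (var g) → ∃ (Limit g)
    Limit-exists g F = from-supremum
      (R.complete P (lower-bound , 0<P) (upper-bound , P-bounded))
      where
      P : Pred R.Carrier ℓ
      P a = ∃ λ k → k ⊩ a · e ≤ g
      lower-bound = proj₁ (proj₂ (F (0 , 0)))
      0<P : P lower-bound
      0<P = proj₁ (F (0 , 0)) , proj₁ (proj₂ (proj₂ (F (0 , 0))))
      upper-bound = lower-bound R.+ R.ε 0
      P-bounded : ∀ a → P a → a R.≤ upper-bound
      P-bounded a (j , ae≤g) = consistent (condition (j ℕ.+ k))
        (≤[]-trans (0≤p (j ℕ.+ k)) (laterˡ {j} {k} ae≤g)
          (laterʳ {j} {k} (proj₂ (proj₂ (proj₂ (F (0 , 0)))))))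
        where k = proj₁ (F (0 , 0))
      from-supremum : ∃ (IsSupremum R._≤_ P) → ∃ (Limit g)
      from-supremum (s , s-sup@(s-upper , _)) = s , upper , lower
        where
        upper-close : ∀ {a} → (∃ λ m → R.ε m R.≤ (a R.+ (R.- s))) → ∃ λ k → k ⊩ g ≤ a · e
        upper-close {a} (m , ε≤a-s) with F (0 , m)
        ... | k , c , ce≤g , g≤ = k , ≤[]-trans (0≤p k) g≤ (≤⇒≤[] (·e-mono
          (R.linear (R.+-mono (s-upper c (k , ce≤g)) ε≤a-s)
            (R.solve 4 (λ c ε s a → (c R.⊕ ε) R.⊕ R.⊖ a R.⊜
              (c R.⊕ ε) R.⊕ R.⊖ (s R.⊕ (a R.⊕ R.⊖ s))) ≡.refl c (R.ε m) s a))))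
        upper : Upper g s
        upper a s<a = upper-close (R.ε-small (R.sub-positive s<a))
        lower-close : ∀ {a} → (∃ λ x → P x × (R.- a) R.< x) → ∃ λ k → k ⊩ neg g ≤ a · e
        lower-close {a} (x , (k , y , disjoint , xe≤g+y) , -a<x) = k , y , disjoint ,
          linear (≤-trans (·e-mono (R.<⇒≤ -a<x)) xe≤g+y)
            (trans (solve 3 (λ g y a → ⊖ g ⊕ ⊖ (a ⊕ y) ⊜ ⊖ a ⊕ ⊖ (g ⊕ y)) ≡.refl g y (a · e))
              (+-cong (sym (-·≈neg· a e)) refl))
        lower : Upper (neg g) (R.- s)
        lower a -s<a = lower-close (R.approximate s-sup (R.neg-<-swap -s<a))

    -- 0 when g has no limit, which may happen only if g does not occur in u.
    value : Carrier → R.Carrier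
    value g with em {∃ (Limit g)}
    ... | yes (r , _) = r
    ... | no  _       = R.0#

    Limit-value : ∀ g → ∃ (Limit g) → Limit g (value g)
    Limit-value g exists with em {∃ (Limit g)}
    ... | yes (_ , lim) = lim
    ... | no  none      = contradiction exists none

    -- Every operation preserves limits along the sequence; for `sup` this rests on its own
    -- requirements `F (0 , m)`.
    Limit-eval : ∀ t → Fulfilled t → Limit (eval G (λ g → g) t) (eval (ℝ-algebra ℝ) value t)
    Limit-eval (var g)   F = Limit-value g (Limit-exists g F)
    Limit-eval 𝟎         F = Limit-zero
    Limit-eval (s ⊞ t)   F = Limit-+ (Limit-eval s (fulfilled s λ j → F (0 , j)))
                                     (Limit-eval t (fulfilled t λ j → F (1 , j)))
    Limit-eval (s ⊻ t)   F = Limit-∨ (Limit-eval s (fulfilled s λ j → F (0 , j)))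
                                     (Limit-eval t (fulfilled t λ j → F (1 , j)))
    Limit-eval (a ⊡ t)   F = Limit-· a (Limit-eval t F)
    Limit-eval (cut t)   F = Limit-trunc (Limit-eval t F)
    Limit-eval (sup t s) F = Limit-⋎
      (λ n → Limit-eval (s n) (fulfilled (s n) λ j → F (2 ℕ.+ n , j)))
      (Limit-eval t (fulfilled t λ j → F (1 , j)))
      (λ m → F (0 , m))

    Limit-value-of-term : Limit (eval G (λ g → g) u) (eval (ℝ-algebra ℝ) value u)
    -- Requirement number `n` is met at stage `suc n`.
    Limit-value-of-term = Limit-eval u (fulfilled u λ n → suc n , p-meets n)

    Upper-× : ∀ n {f} → Upper f R.0# → Upper (n ×ℕ f) R.0#
    Upper-× zero    U = Upper-zero
    Upper-× (suc n) U = Upper-cong refl (R.sym (R.+-identityˡ R.0#)) (Upper-+ U (Upper-× n U))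

    -- Since `e ≤ h`, a limit superior of at most 0 would force `e ≤ c · e` for `c = 1/2`, against
    -- `consistent`.
    ¬Upper-h : ¬ Upper h R.0#
    ¬Upper-h U =
      let c , 0<c , c+c≈1 = R.half R.0<1
          k , h≤ce = U c 0<c
          1≤c = consistent (condition k) (≤[]-trans (0≤p k)
            (≤⇒≤[] (≤-respˡ-≈ (sym (·-identityˡ e)) (T3ʳ h 0≤h))) h≤ce)
      in 0<c (R.linear 1≤c (R.trans
        (R.solve 1 (λ c → c R.⊕ R.⊖ R.𝟘 R.⊜ (c R.⊕ c) R.⊕ R.⊖ c) ≡.refl c)
        (R.+-cong c+c≈1 R.refl)))

-- Generation by the reals

module Generation {ℓ : Level} (em : ExcludedMiddle ℓ) (ℝ : CompleteOrderedField ℓ) where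

  open Terms ℝ
  private
    module R = ClassicalReals em ℝ
    A = ℝ-algebra ℝ

  module _ {G : σAlgebra ℝ} (K-G : IsDedekindσCompleteTruncatedRieszSpace ℝ G) where

    open TruncatedRieszSpace ℝ G K-G

    private
      ⟦_⟧ : Term Carrier → Carrier
      ⟦_⟧ = eval G (λ g → g)

    -- By `T5` it suffices that truncation fixes every multiple of `⟦ u ⟧`. A multiple that it moves
    -- serves as `h`: the valuation obtained by forcing gives `u` its limit, which is 0 by
    -- hypothesis, so `h` has limit superior at most 0, contrary to `¬Upper-h`.
    nonpositive : ∀ u → 0# ≤ ⟦ u ⟧ → (∀ ρ → eval A ρ u R.≈ R.0#) → ⟦ u ⟧ ≤ 0#
    nonpositive u 0≤u u≈0 = ≤-reflexive (T5 ⟦ u ⟧ 0≤u fixed)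
      where
      fixed : ∀ n → n ×ℕ ⟦ u ⟧ ≈ trunc (n ×ℕ ⟦ u ⟧)
      fixed n with em {n ×ℕ ⟦ u ⟧ ≤ trunc (n ×ℕ ⟦ u ⟧)}
      ... | yes h≤trunc-h = ≤-antisym h≤trunc-h (T3ʳ _ (×-nonNeg n 0≤u))
      ... | no  h≰trunc-h = contradiction
        (Upper-× n (Upper-cong refl (R.sym (u≈0 value)) (proj₁ Limit-value-of-term)))
        ¬Upper-h
        where
        open Forcing em ℝ K-G (n ×ℕ ⟦ u ⟧) (×-nonNeg n 0≤u) h≰trunc-h
        open Generic u

    identities-hold : ∀ s t → (∀ ρ → eval A ρ s R.≈ eval A ρ t) → ⟦ s ⟧ ≈ ⟦ t ⟧
    identities-hold s t s≈t = ≤-antisym (half s t s≈t) (half t s λ ρ → R.sym (s≈t ρ))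
      where
      half : ∀ s t → (∀ ρ → eval A ρ s R.≈ eval A ρ t) → ⟦ s ⟧ ≤ ⟦ t ⟧
      -- The difference is made positive: the term `(s ⊞ ⊟ t) ⊻ 𝟎` vanishes identically in ℝ.
      half s t s≈t = linear (≤-trans (≤⁺ _) (nonpositive ((s ⊞ ⊟ t) ⊻ 𝟎) (0≤⁺ _) vanish))
        (solve 2 (λ s t → s ⊕ ⊖ t ⊜ (s ⊕ ⊖ t) ⊕ ⊖ 𝟘) ≡.refl ⟦ s ⟧ ⟦ t ⟧)
        where
        vanish : ∀ ρ → eval A ρ ((s ⊞ ⊟ t) ⊻ 𝟎) R.≈ R.0#
        vanish ρ = R.x≤y⇒x⊔y≈y (R.≤-reflexive (R.trans
          (R.+-cong (s≈t ρ) (R.-1*x≈-x (eval A ρ t))) (R.-‿inverseʳ (eval A ρ t))))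

    -- The subalgebra of ℝ^(ℝ^G) generated by the projections.
    termFunctions : σAlgebra ℝ
    termFunctions = record
      { Carrier       = Term Carrier
      ; _≈_           = λ s t → ∀ ρ → eval A ρ s R.≈ eval A ρ t
      ; isEquivalence = record
        { refl  = λ ρ → R.refl
        ; sym   = λ p ρ → R.sym (p ρ)
        ; trans = λ p q ρ → R.trans (p ρ) (q ρ)
        }
      ; 0#            = 𝟎
      ; _+_           = _⊞_
      ; _∨_           = _⊻_
      ; _·_           = _⊡_
      ; ⋎             = sup
      ; trunc         = cut
      ; +-cong        = λ p q ρ → R.+-cong (p ρ) (q ρ)
      ; ∨-cong        = λ p q ρ → R.⊔-cong (p ρ) (q ρ)
      ; ·-cong        = λ p q ρ → R.*-cong p (q ρ)
      ; ⋎-cong        = λ p q ρ → σAlgebra.⋎-cong A (p ρ) (λ n → q n ρ)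
      ; trunc-cong    = λ p ρ → R.⊓-cong (p ρ) R.refl
      }

    embedding : _EmbedsIn_ ℝ termFunctions (∏ ℝ (Carrier → R.Carrier) (λ _ → A))
    embedding = (λ t ρ → eval A ρ t) , record
      { cong       = λ p → p
      ; 0#-homo    = λ ρ → R.refl
      ; +-homo     = λ s t ρ → R.refl
      ; ∨-homo     = λ s t ρ → R.refl
      ; ·-homo     = λ a t ρ → R.refl
      ; ⋎-homo     = λ t s ρ → R.refl
      ; trunc-homo = λ t ρ → R.refl
      } , λ p → p

    evaluation : _IsHomomorphicImageOf_ ℝ G termFunctions
    evaluation = ⟦_⟧ , record
      -- Evaluation is well defined on term functions because identities of ℝ hold in `G`.
      { cong       = λ {s} {t} → identities-hold s t
      ; 0#-homo    = refl
      ; +-homo     = λ s t → refl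
      ; ∨-homo     = λ s t → refl
      ; ·-homo     = λ a t → refl
      ; ⋎-homo     = λ t s → refl
      ; trunc-homo = λ t → refl
      } , λ g → var g , refl

theorem10p2 : ∀ {ℓ κ : Level} → ExcludedMiddle ℓ → (ℝ : CompleteOrderedField ℓ) →
    (IsDedekindσCompleteTruncatedRieszSpace ℝ (ℝ-algebra ℝ) ×
    ClosedUnderHSP ℝ (IsDedekindσCompleteTruncatedRieszSpace ℝ)) ×
    ((K : Pred (σAlgebra ℝ) κ) → K (ℝ-algebra ℝ) → ClosedUnderHSP ℝ K →
    IsDedekindσCompleteTruncatedRieszSpace ℝ ⊆ K)
theorem10p2 em ℝ =
  (Reals.ℝ-truncatedRieszSpace ℝ , Terms.equational⇒closed ℝ (Axioms.equationalClass ℝ)) ,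
  λ K K-ℝ closed K-G →
    let open ClosedUnderHSP closed; open Generation em ℝ in
    -- The algebra is an image of a subalgebra of a power of ℝ.
    images _ _ (evaluation K-G) (subalgebras _ _ (embedding K-G) (products _ _ λ _ → K-ℝ))
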